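{- For every constant $\alpha>0$, if the $(\alpha,n,k)$-ExpanderMatching problem (defined in the context) can be solved by deterministic oblivious branching programs with space $\widetilde{O}(1)$ and time $\widetilde{O}(k)$, then for every $S\leq n$ there is a deterministic oblivious branching program solving the 2-StepPointerChasing problem (defined in the context) with space $\widetilde{O}(S)$ and time $\widetilde{O}\left(\sqrt{n^{3+\alpha}/S}\right)$.
   Context: $[n]=\{1,\ldots,n\}$. The notation $\widetilde{O}(\cdot)$ hides factors of $\mathrm{polylog}(n)$, regardless of the content of the parentheses; in particular $\widetilde{O}(1)$ means $O(\mathrm{polylog}(n))$. **2-StepPointerChasing.** The input is a function $f:[n]\to[n]$ (given as the list $f(1),\ldots,f(n)$), and the output consists of the pairs $(x,f(f(x)))$ for all $x\in[n]$. **Expanders.** A bipartite graph $\Gamma\subseteq[n]\times[m]$ is a $(k,a)$-expander if for every $L\subseteq[n]$ with $|L|\le k$, the number of neighbors of $L$ in $[m]$ is at least $a\cdot|L|$. By a theorem of Guruswami, Umans and Vadhan, for every constant $\alpha>0$, given $n\in\mathbb{N}$ and $k\le n$, there is an explicitly constructed bipartite graph $\Gamma_{\alpha,n,k}\subseteq[n]\times[m]$ which is a $(k,1)$-expander, with $|\Gamma_{\alpha,n,k}|=\widetilde{O}(n)$ edges and $m\le\widetilde{O}(k^{1+\alpha})$. Fix this family of graphs. **$(\alpha,n,k)$-ExpanderMatching.** This is the function $[n]^k\times[m]\to[n]\cup\{\perp\}$, with $m$ the size of the right side of $\Gamma_{\alpha,n,k}$, defined as follows. Given $L\in[n]^k$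 and $y\in[m]$, regard $L$ as a subset of $[n]$ with $|L|\le k$. By the $(k,1)$-expander property there is a matching for $L$ in $\Gamma_{\alpha,n,k}$; let $\mathcal{M}:L\to[m]$ be the lexicographically smallest matching (injective map with $(v,\mathcal{M}(v))\in\Gamma_{\alpha,n,k}$ for all $v\in L$). The output is $\mathcal{M}^{ -1}(y)$ if it exists, and $\perp$ otherwise. **Branching programs.** A deterministic branching program on inputs $(x_1,\ldots,x_N)\in D^N$ is a layered directed acyclic graph with a unique initial vertex. Each vertex not in the last layer is labeled with an index $i\in[N]$ and has $|D|$ outgoing edges to the next layer, labeled with the elements of $D$. The computation path on an input starts at the initial vertex, at each vertex labeled $i$ queries $x_i$ and follows the outgoing edge labeled with the value of $x_i$, until reaching the last layer. The program has space $S$ and time $T$ if it has at most $T+1$ layers, each containing at most $2^S$ vertices. It is oblivious if within each layer all vertices carry the same index label. For a single-output function, the output is a label on the final vertex of the computation path. For a multi-output function, each edge may output arbitrarily many output statements (here pairs $(x,z)$ claiming $f(f(x))=z$), and the final output is the collection of all output statements on the computation path, which must be complete and consistent. -}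

module Defs where

open import Data.Fin as Fin using (Fin; zero; suc)
open import Data.Fin.Subset as Subset using (Subset; ⋃)
open import Data.Fin.Subset.Properties using (_∈?_)
open import Data.Integer using (+_)
open import Data.List using (List; []; _∷_; concat; map; filter; allFin; sum)
open import Data.List.Membership.Propositional using (_∈_)
open import Data.List.Relation.Unary.All using (All)
open import Data.Maybe using (Maybe; just; nothing)
open import Data.Nat using (ℕ; zero; suc; _+_; _*_; _^_; _≤_; NonZero)
open import Data.Nat.Logarithm using (⌊log₂_⌋)
open import Data.Product using (Σ; ∃; ∃₂; _×_; _,_; proj₁; proj₂)
open import Data.Rational as ℚ using (ℚ; 0ℚ)
open import Data.Sum using (_⊎_)
open import Data.Unit using (⊤)
open import Data.Vec.Functional using (Vector)
open import Function using (_⇔_; _∘_)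
open import Relation.Binary.PropositionalEquality using (_≡_; _≢_)
open import Relation.Nullary using (¬_)

-- Dedekind reals: Below q means q < α, and Above q means α < q.
record ℝ : Set₁ where
  field
    Below Above     : ℚ → Set
    below-inhabited : ∃ Below
    above-inhabited : ∃ Above
    below-rounded   : ∀ q → Below q ⇔ ∃ λ r → q ℚ.< r × Below r
    above-rounded   : ∀ q → Above q ⇔ ∃ λ r → r ℚ.< q × Above r
    disjoint        : ∀ q → ¬ (Below q × Above q)
    located         : ∀ q r → q ℚ.< r → Below q ⊎ Above r

Positive : ℝ → Set
Positive α = ℝ.Below α 0ℚ

-- The real inequality  x ≤ c · b^(e+α)  for α > 0. By continuity and
-- monotonicity of the exponential it holds iff  x ≤ c · b^(e+p/q)  for every
-- rational p/q > α, and each of these is raised to the power q. Naturals p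
-- suffice, as a rational above a positive α is positive.
PowerBound : (α : ℝ) (x c b e : ℕ) → Set
PowerBound α x c b e =
  ∀ (p q : ℕ) .{{_ : NonZero q}} → ℝ.Above α (+ p ℚ./ q) →
  x ^ q ≤ c ^ q * b ^ (e * q + p)

-- The factors hidden by Õ, as functions of n. The 1 + keeps the bound
-- positive at n = 1.
Polylog : (ℕ → ℕ) → Set
Polylog g = ∃₂ λ C c → ∀ n → g n ≤ C * (1 + ⌊log₂ n ⌋) ^ c

-- A bipartite graph on [n] and [m], given by the neighbourhoods of the
-- left vertices.
BipartiteGraph : ℕ → ℕ → Set
BipartiteGraph n m = Fin n → Subset m

edgeCount : ∀ {n m} → BipartiteGraph n m → ℕ
edgeCount {n} Γ = sum (map (Subset.∣_∣ ∘ Γ) (allFin n))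

neighbours : ∀ {n m} → BipartiteGraph n m → Subset n → Subset m
neighbours {n} Γ L = ⋃ (map Γ (filter (_∈? L) (allFin n)))

IsExpander : ∀ {n m} (k a : ℕ) → BipartiteGraph n m → Set
IsExpander {n} k a Γ =
  ∀ (L : Subset n) → Subset.∣ L ∣ ≤ k →
  a * Subset.∣ L ∣ ≤ Subset.∣ neighbours Γ L ∣

-- A family with the parameters of the Guruswami–Umans–Vadhan graphs for the
-- constant α; the values of m and Γ outside 1 ≤ k ≤ n are irrelevant.
record ExpanderFamily (α : ℝ) : Set where
  field
    m           : ℕ → ℕ → ℕ
    Γ           : (n k : ℕ) → BipartiteGraph n (m n k)
    isExpander  : ∀ n k → 1 ≤ k → k ≤ n → IsExpander k 1 (Γ n k)
    edges-bound : ∃ λ g → Polylog g ×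
                  (∀ n k → 1 ≤ k → k ≤ n → edgeCount (Γ n k) ≤ g n * n)
    right-bound : ∃ λ g → Polylog g ×
                  (∀ n k → 1 ≤ k → k ≤ n → PowerBound α (m n k) (g n) k 1)

-- Input variables x_i, i ∈ [N], where x_i ranges over a domain of D i
-- elements. A common domain is the case of constant D.
Input : ∀ {N} → (Fin N → ℕ) → Set
Input {N} D = (i : Fin N) → Fin (D i)

-- One layer with w vertices together with its edges, each labelled by an
-- element of E, to the next layer with w′ vertices.
record Layer {N} (D : Fin N → ℕ) (E : Set) (w w′ : ℕ) : Set where
  field
    query : Fin w → Fin N
    edge  : (u : Fin w) → Fin (D (query u)) → Fin w′ × E

-- Layers D E T w w′ has T edge levels, hence T + 1 layers of vertices; the
-- first has w vertices and the last has w′.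
infixr 5 _∷_
data Layers {N} (D : Fin N → ℕ) (E : Set) : ℕ → ℕ → ℕ → Set where
  []  : ∀ {w} → Layers D E 0 w w
  _∷_ : ∀ {T w w′ w″} →
        Layer D E w w′ → Layers D E T w′ w″ → Layers D E (suc T) w w″

module _ {N} {D : Fin N → ℕ} {E : Set} where

  widths : ∀ {T w w′} → Layers D E T w w′ → List ℕ
  widths {w = w} []       = w ∷ []
  widths {w = w} (_ ∷ ls) = w ∷ widths ls

  ObliviousLayers : ∀ {T w w′} → Layers D E T w w′ → Set
  ObliviousLayers []       = ⊤
  ObliviousLayers (l ∷ ls) =
    (∀ u v → Layer.query l u ≡ Layer.query l v) × ObliviousLayers ls

  -- The final vertex and the edge labels of the computation path from u.
  run : ∀ {T w w′} → Layers D E T w w′ → Input D → Fin w → Fin w′ × List E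
  run []       x u = u , []
  run (l ∷ ls) x u =
    let (v , e)  = Layer.edge l u (x (Layer.query l u))
        (t , es) = run ls x v
    in t , e ∷ es

-- Branching programs with edge labels in E and labels in Z on the vertices of
-- the last layer. The first layer consists of the initial vertex.
record Program {N} (D : Fin N → ℕ) (E Z : Set) : Set where
  field
    time   : ℕ
    {last} : ℕ
    layers : Layers D E time 1 last
    label  : Fin last → Z

module _ {N} {D : Fin N → ℕ} {E Z : Set} (P : Program D E Z) where
  open Program P

  Oblivious : Set
  Oblivious = ObliviousLayers layers

  HasSpace : ℕ → Set
  HasSpace s = All (_≤ 2 ^ s) (widths layers)

  finalLabel : Input D → Z
  finalLabel x = label (proj₁ (run layers x zero))

  edgeLabels : Input D → List E
  edgeLabels x = proj₂ (run layers x zero)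

SingleOutputProgram : ∀ {N} (D : Fin N → ℕ) (Z : Set) → Set
SingleOutputProgram D Z = Program D ⊤ Z

MultiOutputProgram : ∀ {N} (D : Fin N → ℕ) (O : Set) → Set
MultiOutputProgram D O = Program D (List O) ⊤

outputs : ∀ {N} {D : Fin N → ℕ} {O : Set} →
          MultiOutputProgram D O → Input D → List O
outputs P x = concat (edgeLabels P x)

-- A k-tuple regarded as the set of its entries.
_∈ₜ_ : ∀ {n k} → Fin n → Vector (Fin n) k → Set
v ∈ₜ L = ∃ λ i → L i ≡ v

module _ {n m k} (Γ : BipartiteGraph n m) (L : Vector (Fin n) k) where

  -- A map L → [m] is represented by a map on all of [n]; its values outside L
  -- are never inspected.
  IsMatching : (Fin n → Fin m) → Set
  IsMatching M =
    (∀ v → v ∈ₜ L → M v Subset.∈ Γ v) ×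
    (∀ u v → u ∈ₜ L → v ∈ₜ L → M u ≡ M v → u ≡ v)

  -- Lexicographic comparison of the values listed by increasing v ∈ L.
  _≤lex_ : (Fin n → Fin m) → (Fin n → Fin m) → Set
  M ≤lex M′ =
    (∀ v → v ∈ₜ L → M v ≡ M′ v) ⊎
    (∃ λ v → v ∈ₜ L × M v Fin.< M′ v ×
             (∀ u → u ∈ₜ L → u Fin.< v → M u ≡ M′ u))

  IsSmallestMatching : (Fin n → Fin m) → Set
  IsSmallestMatching M =
    IsMatching M × (∀ M′ → IsMatching M′ → M ≤lex M′)

  IsPreimage : (Fin n → Fin m) → Fin m → Maybe (Fin n) → Set
  IsPreimage M y (just v) = v ∈ₜ L × M v ≡ y
  IsPreimage M y nothing  = ∀ v → v ∈ₜ L → M v ≢ y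

  -- z is the output of ExpanderMatching on (L , y), with nothing for ⊥. When Γ
  -- is a (k,1)-expander the smallest matching exists by Hall's theorem, and it
  -- is unique on L, so exactly one z qualifies.
  IsExpanderMatchingOutput : Fin m → Maybe (Fin n) → Set
  IsExpanderMatchingOutput y z = ∀ M → IsSmallestMatching M → IsPreimage M y z

-- Variable 0 is y ∈ [m]; variables 1, …, k are the entries of L ∈ [n]^k.
expanderMatchingDomain : (n m k : ℕ) → Fin (suc k) → ℕ
expanderMatchingDomain n m k zero    = m
expanderMatchingDomain n m k (suc _) = n

SolvesExpanderMatching :
  ∀ {n m k} → BipartiteGraph n m →
  SingleOutputProgram (expanderMatchingDomain n m k) (Maybe (Fin n)) → Set
SolvesExpanderMatching {n} {m} {k} Γ P =
  ∀ (x : Input (expanderMatchingDomain n m k)) →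
  IsExpanderMatchingOutput Γ (λ i → x (suc i)) (x zero) (finalLabel P x)

pointerChasingDomain : (n : ℕ) → Fin n → ℕ
pointerChasingDomain n _ = n

-- Completeness and consistency of the output statements (x , f (f x)).
SolvesPointerChasing :
  ∀ {n} → MultiOutputProgram (pointerChasingDomain n) (Fin n × Fin n) → Set
SolvesPointerChasing {n} P =
  ∀ (f : Fin n → Fin n) x z → (x , z) ∈ outputs P f ⇔ z ≡ f (f x)

-- Space Õ(1) and time Õ(k).
ExpanderMatchingEasy : ∀ {α} → ExpanderFamily α → Set
ExpanderMatchingEasy F =
  ∃₂ λ (s t : ℕ → ℕ) → Polylog s × Polylog t ×
  (∀ n k → 1 ≤ k → k ≤ n →
   Σ (SingleOutputProgram (expanderMatchingDomain n (m n k) k) (Maybe (Fin n)))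
   λ P → Oblivious P × HasSpace P (s n) × Program.time P ≤ t n * k ×
         SolvesExpanderMatching (Γ n k) P)
  where open ExpanderFamily F

-- Space Õ(S) and time Õ(√(n^(3+α)/S)). The time bound T ≤ t · √(n^(3+α)/S) is
-- stated as T² · S ≤ t² · n^(3+α).
PointerChasingEasy : ℝ → Set
PointerChasingEasy α =
  ∃₂ λ (s t : ℕ → ℕ) → Polylog s × Polylog t ×
  (∀ n S → 1 ≤ S → S ≤ n →
   Σ (MultiOutputProgram (pointerChasingDomain n) (Fin n × Fin n))
   λ P → Oblivious P × HasSpace P (s n * S) ×
         PowerBound α (Program.time P ^ 2 * S) (t n ^ 2) n 3 ×
         SolvesPointerChasing P)

{-# OPTIONS --safe #-}

-- Let L be the set of values of f on a block of k arguments, with smallest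
-- matching M. Every v ∈ L is the output of ExpanderMatching on (L , M v). The
-- oblivious programs for S right vertices y run in parallel on the same
-- queries; then f (v) for their outputs v is found by querying only the
-- neighbours of these y, which is one pass over the edges of Γ when summed over
-- all y; finally a second pass over the block emits the pairs (x , f (f x)).
-- The n/k blocks take time Õ(n m / S + n² / k), where m ≤ Õ(k^(1+α)), and this
-- is Õ(√(n^(3+α) / S)) for k^(2+2α) ≈ n^(1+α) S.
--
-- As α is a Dedekind real, the program does not compute this k: it uses the k
-- that minimises an explicit time bound, and the balanced k, with a rational
-- exponent above α, occurs in the analysis only. Correctness is decidable, so
-- the smallest matching is needed up to double negation only.
module Submission where

open import Defs

open import Algebra.Properties.CommutativeSemigroup using (x∙yz≈y∙xz)
open import Data.Bool using (true; false; if_then_else_)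
open import Data.Empty using (⊥)
open import Data.Fin as Fin using (Fin; zero; suc; toℕ; fromℕ<; inject≤)
open import Data.Fin.Properties as Fin
  using (toℕ-injective; toℕ-inject≤; toℕ<n; fromℕ<-toℕ; fromℕ<-cong; remQuot-combine)
open import Data.Fin.Subset as Subset using (Subset; ⋃; ⁅_⁆; _∪_; _∩_; _⊆_; _-_; ∣_∣)
open import Data.Fin.Subset.Properties
open import Data.List
  using (List; []; _∷_; _++_; allFin; concat; concatMap; drop; filter; length; map; tabulate)
open import Data.List.Membership.Propositional using (_∈_)
open import Data.List.Membership.Propositional.Properties
open import Data.List.Properties
  using (++-assoc; length-++; length-drop; length-map; length-tabulate; map-++; map-cong)
open import Data.List.Relation.Unary.All using (All; []; _∷_)
open import Data.List.Relation.Unary.Any using (here; there)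
open import Data.Maybe using (Maybe; just; nothing; fromMaybe)
open import Data.Maybe.Properties as Maybe using (just-injective)
open import Data.Nat using (ℕ; zero; suc; _+_; _*_; _^_; _/_; _%_; _≤_; _<_; z≤n; s≤s;
  _≤?_; _<?_; NonZero; >-nonZero; >-nonZero⁻¹)
open import Data.Nat.DivMod using (m/n*n≤m; m≡m%n+[m/n]*n; m%n<n)
open import Data.Nat.Induction using (<-rec)
open import Data.Nat.ListAction using (sum)
open import Data.Nat.Logarithm using (⌊log₂_⌋; ⌊log₂⌋-mono-≤; ⌊log₂[2^n]⌋≡n)
open import Data.Nat.Properties hiding (_≟_)
open import Data.Nat.Tactic.RingSolver using (solve-∀)
open import Data.Product using (Σ; ∃; ∃₂; _×_; _,_; proj₁; proj₂)
open import Data.Product.Properties using (≡-dec)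
open import Data.Sum using (_⊎_; inj₁; inj₂)
open import Data.Unit using (⊤; tt)
open import Data.Vec as Vec using (Vec; []; _∷_; lookup; replicate)
open import Data.Vec.Functional using (Vector)
open import Data.Vec.Properties using (lookup∘tabulate)
open import Effect.Monad using (RawMonad)
open import Function using (_∘_; _⇔_; mk⇔; it)
open import Level using (0ℓ)
open import Relation.Binary.PropositionalEquality
open import Relation.Nullary using (¬_; Dec; yes; no; does; contradiction)
open import Relation.Nullary.Decidable using (¬¬-excluded-middle; decidable-stable)
open import Relation.Nullary.Negation using (¬¬-Monad)
open import Relation.Unary using (Decidable)

open RawMonad (¬¬-Monad {0ℓ}) using (_>>=_; pure)

-- Matchings

-- If no least witness existed, strong induction would refute every witness: with all smaller ones
-- refuted, `a` itself would be least. `Q` need not be decidable, hence the double negation.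
¬¬-least : (Q : ℕ → Set) → ∀ {a} → Q a →
           ¬ ¬ (∃ λ b → Q b × (∀ c → Q c → b ≤ c))
¬¬-least Q = <-rec (λ a → Q a → ¬ ¬ (∃ λ b → Q b × (∀ c → Q c → b ≤ c)))
  (λ _ rec qa k → k (_ , qa , λ c qc → ≮⇒≥ λ c<a → rec c<a qc k)) _

-- Cardinalities of finite subsets

∣p∪q∣+∣p∩q∣≡∣p∣+∣q∣ : ∀ {n} (p q : Subset n) →
                      ∣ p ∪ q ∣ + ∣ p ∩ q ∣ ≡ ∣ p ∣ + ∣ q ∣
∣p∪q∣+∣p∩q∣≡∣p∣+∣q∣ []          []          = refl
∣p∪q∣+∣p∩q∣≡∣p∣+∣q∣ (false ∷ p) (false ∷ q) = ∣p∪q∣+∣p∩q∣≡∣p∣+∣q∣ p q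
∣p∪q∣+∣p∩q∣≡∣p∣+∣q∣ (false ∷ p) (true  ∷ q) =
  trans (cong suc (∣p∪q∣+∣p∩q∣≡∣p∣+∣q∣ p q)) (sym (+-suc _ _))
∣p∪q∣+∣p∩q∣≡∣p∣+∣q∣ (true  ∷ p) (false ∷ q) = cong suc (∣p∪q∣+∣p∩q∣≡∣p∣+∣q∣ p q)
∣p∪q∣+∣p∩q∣≡∣p∣+∣q∣ (true  ∷ p) (true  ∷ q) = cong suc
  (trans (+-suc _ _) (trans (cong suc (∣p∪q∣+∣p∩q∣≡∣p∣+∣q∣ p q)) (sym (+-suc _ _))))

∣p∪q∣≤∣p∣+∣q∣ : ∀ {n} (p q : Subset n) → ∣ p ∪ q ∣ ≤ ∣ p ∣ + ∣ q ∣
∣p∪q∣≤∣p∣+∣q∣ p q = subst (∣ p ∪ q ∣ ≤_) (∣p∪q∣+∣p∩q∣≡∣p∣+∣q∣ p q) (m≤m+n _ _)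

∣p∣≤1+∣p-x∣ : ∀ {n} (p : Subset n) x → ∣ p ∣ ≤ 1 + ∣ p - x ∣
∣p∣≤1+∣p-x∣ p x = begin
  ∣ p ∣                 ≤⟨ p⊆q⇒∣p∣≤∣q∣ split ⟩
  ∣ ⁅ x ⁆ ∪ (p - x) ∣   ≤⟨ ∣p∪q∣≤∣p∣+∣q∣ ⁅ x ⁆ (p - x) ⟩
  ∣ ⁅ x ⁆ ∣ + ∣ p - x ∣ ≡⟨ cong (_+ ∣ p - x ∣) (∣⁅x⁆∣≡1 x) ⟩
  1 + ∣ p - x ∣         ∎
  where
  open ≤-Reasoning
  split : p ⊆ ⁅ x ⁆ ∪ (p - x)
  split {y} y∈p with y Fin.≟ x
  ... | yes refl = x∈p∪q⁺ (inj₁ (x∈⁅x⁆ x))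
  ... | no  y≢x  = x∈p∪q⁺ {p = ⁅ x ⁆} (inj₂ (x∈p∧x≢y⇒x∈p-y y∈p y≢x))

x∉p-x : ∀ {n} (p : Subset n) x → ¬ (x Subset.∈ p - x)
x∉p-x (_ ∷ p) (suc x) (Vec.there h) = x∉p-x p x h

0<∣p∣⇒Nonempty : ∀ {n} (p : Subset n) → 0 < ∣ p ∣ → Subset.Nonempty p
0<∣p∣⇒Nonempty {n} p 0<∣p∣ with nonempty? p
... | yes ne = ne
... | no ¬ne = contradiction
  (trans (cong ∣_∣ (Empty-unique ¬ne)) (∣⊥∣≡0 n)) (≢-sym (<⇒≢ 0<∣p∣))

∣⁅x⁆∪⁅y⁆∣≡2 : ∀ {n} {x y : Fin n} → x ≢ y → ∣ ⁅ x ⁆ ∪ ⁅ y ⁆ ∣ ≡ 2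
∣⁅x⁆∪⁅y⁆∣≡2 {n} {x} {y} x≢y = begin
  ∣ ⁅ x ⁆ ∪ ⁅ y ⁆ ∣                       ≡⟨ +-identityʳ _ ⟨
  ∣ ⁅ x ⁆ ∪ ⁅ y ⁆ ∣ + 0                   ≡⟨ cong (∣ ⁅ x ⁆ ∪ ⁅ y ⁆ ∣ +_) disjoint ⟨
  ∣ ⁅ x ⁆ ∪ ⁅ y ⁆ ∣ + ∣ ⁅ x ⁆ ∩ ⁅ y ⁆ ∣   ≡⟨ ∣p∪q∣+∣p∩q∣≡∣p∣+∣q∣ ⁅ x ⁆ ⁅ y ⁆ ⟩
  ∣ ⁅ x ⁆ ∣ + ∣ ⁅ y ⁆ ∣                   ≡⟨ cong₂ _+_ (∣⁅x⁆∣≡1 x) (∣⁅x⁆∣≡1 y) ⟩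
  2                                       ∎
  where
  open ≡-Reasoning
  disjoint : ∣ ⁅ x ⁆ ∩ ⁅ y ⁆ ∣ ≡ 0
  disjoint = trans (cong ∣_∣ (Empty-unique λ (z , h) →
    let (zx , zy) = x∈p∩q⁻ ⁅ x ⁆ ⁅ y ⁆ h
    in x≢y (trans (sym (x∈⁅y⁆⇒x≡y x zx)) (x∈⁅y⁆⇒x≡y y zy)))) (∣⊥∣≡0 n)

∈-⋃⁺ : ∀ {n} {x : Fin n} {p ps} → p ∈ ps → x Subset.∈ p → x Subset.∈ ⋃ ps
∈-⋃⁺ (here refl) x∈p = x∈p∪q⁺ (inj₁ x∈p)
∈-⋃⁺ {ps = q ∷ _} (there p∈ps) x∈p = x∈p∪q⁺ {p = q} (inj₂ (∈-⋃⁺ p∈ps x∈p))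

∈-⋃⁻ : ∀ {n} {x : Fin n} ps → x Subset.∈ ⋃ ps → ∃ λ p → p ∈ ps × x Subset.∈ p
∈-⋃⁻ []       x∈ = contradiction x∈ ∉⊥
∈-⋃⁻ (q ∷ ps) x∈ with x∈p∪q⁻ q (⋃ ps) x∈
... | inj₁ x∈q = q , here refl , x∈q
... | inj₂ x∈⋃ = let (p , p∈ps , x∈p) = ∈-⋃⁻ ps x∈⋃ in p , there p∈ps , x∈p

sum-map-mono-≤ : ∀ {A : Set} {f g : A → ℕ} (xs : List A) →
                 (∀ x → f x ≤ g x) → sum (map f xs) ≤ sum (map g xs)
sum-map-mono-≤ []       f≤g = z≤n
sum-map-mono-≤ (x ∷ xs) f≤g = +-mono-≤ (f≤g x) (sum-map-mono-≤ xs f≤g)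

sum-map-mono-< : ∀ {A : Set} {f g : A → ℕ} {x xs} → (∀ x → f x ≤ g x) →
                 x ∈ xs → f x < g x → sum (map f xs) < sum (map g xs)
sum-map-mono-< {xs = _ ∷ xs} f≤g (here refl) fx<gx =
  +-mono-<-≤ fx<gx (sum-map-mono-≤ xs f≤g)
sum-map-mono-< {xs = y ∷ _} f≤g (there x∈xs) fx<gx =
  +-mono-≤-< (f≤g y) (sum-map-mono-< f≤g x∈xs fx<gx)

-- Hall's theorem

module _ {n m : ℕ} where

  ∈-neighbours⁺ : ∀ (Γ : BipartiteGraph n m) {A v y} →
                  v Subset.∈ A → y Subset.∈ Γ v → y Subset.∈ neighbours Γ A
  ∈-neighbours⁺ Γ {A} v∈A = ∈-⋃⁺ (∈-map⁺ Γ (∈-filter⁺ (_∈? A) (∈-allFin _) v∈A))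

  ∈-neighbours⁻ : ∀ (Γ : BipartiteGraph n m) A {y} → y Subset.∈ neighbours Γ A →
                  ∃ λ v → v Subset.∈ A × y Subset.∈ Γ v
  ∈-neighbours⁻ Γ A y∈ with ∈-⋃⁻ _ y∈
  ... | p , p∈ , y∈p with ∈-map⁻ Γ p∈
  ... | v , v∈ , refl = v , proj₂ (∈-filter⁻ (_∈? A) {xs = allFin n} v∈) , y∈p

  HallCondition : BipartiteGraph n m → Subset n → Set
  HallCondition Γ L = ∀ A → A ⊆ L → ∣ A ∣ ≤ ∣ neighbours Γ A ∣

  ¬Hall⇒deficient : ∀ Γ L → ¬ HallCondition Γ L →
                    ¬ ¬ (∃ λ A → A ⊆ L × ∣ neighbours Γ A ∣ < ∣ A ∣)
  ¬Hall⇒deficient Γ L ¬H k = ¬H λ A A⊆L → ≮⇒≥ λ N<A → k (A , A⊆L , N<A)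

  deleteEdge : BipartiteGraph n m → Fin n → Fin m → BipartiteGraph n m
  deleteEdge Γ x y v with v Fin.≟ x
  ... | yes _ = Γ v - y
  ... | no  _ = Γ v

  deleteEdge-⊆ : ∀ Γ x y v → deleteEdge Γ x y v ⊆ Γ v
  deleteEdge-⊆ Γ x y v with v Fin.≟ x
  ... | yes _ = p─q⊆p (Γ v) ⁅ y ⁆
  ... | no  _ = λ h → h

  ∈-deleteEdge-≢ˡ : ∀ Γ {x y v z} → v ≢ x → z Subset.∈ Γ v →
                    z Subset.∈ deleteEdge Γ x y v
  ∈-deleteEdge-≢ˡ Γ {x} {v = v} v≢x z∈ with v Fin.≟ x
  ... | yes v≡x = contradiction v≡x v≢x
  ... | no  _   = z∈

  ∈-deleteEdge-≢ʳ : ∀ Γ {x y v z} → z ≢ y → z Subset.∈ Γ v →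
                    z Subset.∈ deleteEdge Γ x y v
  ∈-deleteEdge-≢ʳ Γ {x} {v = v} z≢y z∈ with v Fin.≟ x
  ... | yes _ = x∈p∧x≢y⇒x∈p-y z∈ z≢y
  ... | no  _ = z∈

  edgeCount-deleteEdge : ∀ Γ {x y} → y Subset.∈ Γ x →
                         edgeCount (deleteEdge Γ x y) < edgeCount Γ
  edgeCount-deleteEdge Γ {x} {y} y∈Γx = sum-map-mono-<
    (λ v → p⊆q⇒∣p∣≤∣q∣ (deleteEdge-⊆ Γ x y v)) (∈-allFin x) strict
    where
    strict : ∣ deleteEdge Γ x y x ∣ < ∣ Γ x ∣
    strict with x Fin.≟ x
    ... | yes _  = x∈p⇒∣p-x∣<∣p∣ y∈Γx
    ... | no x≢x = contradiction refl x≢x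

  -- Rado's argument: sets deficient after the deletion of one of the two edges
  -- both contain x, and by submodularity their union and their intersection
  -- without x cannot both satisfy Hall's condition in Γ.
  deleteEdge-Hall : ∀ Γ {L x y₁ y₂} → HallCondition Γ L → y₁ ≢ y₂ →
                    ¬ HallCondition (deleteEdge Γ x y₁) L →
                    ¬ ¬ HallCondition (deleteEdge Γ x y₂) L
  deleteEdge-Hall Γ {L} {x} {y₁} {y₂} H y₁≢y₂ ¬H₁ ¬H₂ =
    ¬Hall⇒deficient _ L ¬H₁ λ (A₁ , A₁⊆L , lt₁) →
    ¬Hall⇒deficient _ L ¬H₂ λ (A₂ , A₂⊆L , lt₂) →
    collide A₁ A₂ A₁⊆L A₂⊆L lt₁ lt₂
    where
    deficient∋x : ∀ {y} A → A ⊆ L → ∣ neighbours (deleteEdge Γ x y) A ∣ < ∣ A ∣ →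
                  x Subset.∈ A
    deficient∋x {y} A A⊆L lt with x ∈? A
    ... | yes x∈A = x∈A
    -- The deletion affects only the neighbourhood of `x`, so a set without `x` keeps its neighbours
    -- and cannot be deficient.
    ... | no  x∉A = contradiction lt (≤⇒≯ (≤-trans (H A A⊆L) (p⊆q⇒∣p∣≤∣q∣ λ z∈ →
      let (v , v∈A , z∈Γv) = ∈-neighbours⁻ Γ A z∈ in
      ∈-neighbours⁺ (deleteEdge Γ x y) v∈A
        (∈-deleteEdge-≢ˡ Γ (λ v≡x → x∉A (subst (Subset._∈ A) v≡x v∈A)) z∈Γv))))

    collide : ∀ A₁ A₂ → A₁ ⊆ L → A₂ ⊆ L →
              ∣ neighbours (deleteEdge Γ x y₁) A₁ ∣ < ∣ A₁ ∣ →
              ∣ neighbours (deleteEdge Γ x y₂) A₂ ∣ < ∣ A₂ ∣ → ⊥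
    collide A₁ A₂ A₁⊆L A₂⊆L lt₁ lt₂ = <-irrefl refl (begin-strict
      1 + (∣ N₁ ∣ + ∣ N₂ ∣)                           <⟨ s≤s (+-monoʳ-< ∣ N₁ ∣ ≤-refl) ⟩
      suc ∣ N₁ ∣ + suc ∣ N₂ ∣                         ≤⟨ +-mono-≤ lt₁ lt₂ ⟩
      ∣ A₁ ∣ + ∣ A₂ ∣                                 ≡⟨ ∣p∪q∣+∣p∩q∣≡∣p∣+∣q∣ A₁ A₂ ⟨
      ∣ A₁ ∪ A₂ ∣ + ∣ A₁ ∩ A₂ ∣
        -- Removing `x` from the intersection costs one, but the two deficiencies contribute two, so
        -- a contradiction remains.
        ≤⟨ +-mono-≤ (H _ ∪⊆L) (∣p∣≤1+∣p-x∣ (A₁ ∩ A₂) x) ⟩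
      ∣ neighbours Γ (A₁ ∪ A₂) ∣ + (1 + ∣ A₁ ∩ A₂ - x ∣)
        ≤⟨ +-mono-≤ (p⊆q⇒∣p∣≤∣q∣ N∪) (s≤s (≤-trans (H _ ∩⊆L) (p⊆q⇒∣p∣≤∣q∣ N∩))) ⟩
      ∣ N₁ ∪ N₂ ∣ + (1 + ∣ N₁ ∩ N₂ ∣)                 ≡⟨ +-suc _ _ ⟩
      1 + (∣ N₁ ∪ N₂ ∣ + ∣ N₁ ∩ N₂ ∣)                 ≡⟨ cong suc (∣p∪q∣+∣p∩q∣≡∣p∣+∣q∣ N₁ N₂) ⟩
      1 + (∣ N₁ ∣ + ∣ N₂ ∣)                           ∎)
      where
      open ≤-Reasoning
      N₁ = neighbours (deleteEdge Γ x y₁) A₁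
      N₂ = neighbours (deleteEdge Γ x y₂) A₂

      ∪⊆L : A₁ ∪ A₂ ⊆ L
      ∪⊆L v∈ with x∈p∪q⁻ A₁ A₂ v∈
      ... | inj₁ v∈A₁ = A₁⊆L v∈A₁
      ... | inj₂ v∈A₂ = A₂⊆L v∈A₂

      ∩⊆L : A₁ ∩ A₂ - x ⊆ L
      ∩⊆L v∈ = A₁⊆L (proj₁ (x∈p∩q⁻ A₁ A₂ (p─q⊆p (A₁ ∩ A₂) ⁅ x ⁆ v∈)))

      -- As `y₁ ≢ y₂`, each edge at `x` survives at least one of the two deletions, and `x` lies in
      -- both sets, so either one can account for it.
      N∪ : neighbours Γ (A₁ ∪ A₂) ⊆ N₁ ∪ N₂
      N∪ {z} z∈ with ∈-neighbours⁻ Γ (A₁ ∪ A₂) z∈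
      ... | v , v∈ , z∈Γv with v Fin.≟ x
      ... | yes refl with z Fin.≟ y₁
      ...   | no  z≢y₁ = x∈p∪q⁺ (inj₁ (∈-neighbours⁺ (deleteEdge Γ x y₁)
                (deficient∋x A₁ A₁⊆L lt₁) (∈-deleteEdge-≢ʳ Γ z≢y₁ z∈Γv)))
      ...   | yes refl = x∈p∪q⁺ {p = N₁} (inj₂ (∈-neighbours⁺ (deleteEdge Γ x y₂)
                (deficient∋x A₂ A₂⊆L lt₂) (∈-deleteEdge-≢ʳ Γ y₁≢y₂ z∈Γv)))
      N∪ z∈ | v , v∈ , z∈Γv | no v≢x with x∈p∪q⁻ A₁ A₂ v∈
      ...   | inj₁ v∈A₁ = x∈p∪q⁺ (inj₁ (∈-neighbours⁺ (deleteEdge Γ x y₁)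
                v∈A₁ (∈-deleteEdge-≢ˡ Γ v≢x z∈Γv)))
      ...   | inj₂ v∈A₂ = x∈p∪q⁺ {p = N₁} (inj₂ (∈-neighbours⁺ (deleteEdge Γ x y₂)
                v∈A₂ (∈-deleteEdge-≢ˡ Γ v≢x z∈Γv)))

      -- With `x` removed, every edge concerned survives both deletions.
      N∩ : neighbours Γ (A₁ ∩ A₂ - x) ⊆ N₁ ∩ N₂
      N∩ z∈ with ∈-neighbours⁻ Γ (A₁ ∩ A₂ - x) z∈
      ... | v , v∈ , z∈Γv = x∈p∩q⁺
        ( ∈-neighbours⁺ (deleteEdge Γ x y₁) v∈A₁ (∈-deleteEdge-≢ˡ Γ v≢x z∈Γv)
        , ∈-neighbours⁺ (deleteEdge Γ x y₂) v∈A₂ (∈-deleteEdge-≢ˡ Γ v≢x z∈Γv) )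
        where
        v≢x : v ≢ x
        v≢x refl = x∉p-x (A₁ ∩ A₂) x v∈
        v∈A₁ : v Subset.∈ A₁
        v∈A₁ = proj₁ (x∈p∩q⁻ A₁ A₂ (p─q⊆p (A₁ ∩ A₂) ⁅ x ⁆ v∈))
        v∈A₂ : v Subset.∈ A₂
        v∈A₂ = proj₂ (x∈p∩q⁻ A₁ A₂ (p─q⊆p (A₁ ∩ A₂) ⁅ x ⁆ v∈))

  MatchesOn : BipartiteGraph n m → Subset n → (Fin n → Fin m) → Set
  MatchesOn Γ L M =
    (∀ v → v Subset.∈ L → M v Subset.∈ Γ v) ×
    (∀ u v → u Subset.∈ L → v Subset.∈ L → M u ≡ M v → u ≡ v)

  -- When no left vertex has two neighbours, Hall's condition is needed on singletons, where it
  -- gives each vertex of `L` its neighbour, and on pairs, where it forbids two vertices to share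
  -- one. `y₀` is the value at isolated vertices, which lie outside `L`.
  hall-single : ∀ Γ L → Fin m → HallCondition Γ L →
                (∀ v {y z} → y Subset.∈ Γ v → z Subset.∈ Γ v → y ≡ z) →
                ∃ (MatchesOn Γ L)
  hall-single Γ L y₀ H unique = M , M∈ , M-injective
    where
    M : Fin n → Fin m
    M v with nonempty? (Γ v)
    ... | yes (y , _) = y
    ... | no  _       = y₀

    singleton⊆L : ∀ {v} → v Subset.∈ L → ⁅ v ⁆ ⊆ L
    singleton⊆L {v} v∈L u∈ = subst (Subset._∈ L) (sym (x∈⁅y⁆⇒x≡y v u∈)) v∈L

    M∈ : ∀ v → v Subset.∈ L → M v Subset.∈ Γ v
    M∈ v v∈L with nonempty? (Γ v)
    ... | yes (_ , y∈) = y∈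
    ... | no  empty with 0<∣p∣⇒Nonempty (neighbours Γ ⁅ v ⁆)
            (subst (_≤ ∣ neighbours Γ ⁅ v ⁆ ∣) (∣⁅x⁆∣≡1 v) (H ⁅ v ⁆ (singleton⊆L v∈L)))
    ... | y , y∈ with ∈-neighbours⁻ Γ ⁅ v ⁆ y∈
    ... | u , u∈ , y∈Γu with refl ← x∈⁅y⁆⇒x≡y v u∈ = contradiction (y , y∈Γu) empty

    M-injective : ∀ u v → u Subset.∈ L → v Subset.∈ L → M u ≡ M v → u ≡ v
    M-injective u v u∈L v∈L Mu≡Mv with u Fin.≟ v
    ... | yes u≡v = u≡v
    ... | no  u≢v = contradiction (begin
      2                             ≡⟨ ∣⁅x⁆∪⁅y⁆∣≡2 u≢v ⟨
      ∣ ⁅ u ⁆ ∪ ⁅ v ⁆ ∣             ≤⟨ H _ pair⊆L ⟩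
      ∣ neighbours Γ (⁅ u ⁆ ∪ ⁅ v ⁆) ∣ ≤⟨ p⊆q⇒∣p∣≤∣q∣ N⊆ ⟩
      ∣ ⁅ M v ⁆ ∣                   ≡⟨ ∣⁅x⁆∣≡1 (M v) ⟩
      1                             ∎) 1+n≰n
      where
      open ≤-Reasoning
      pair⊆L : ⁅ u ⁆ ∪ ⁅ v ⁆ ⊆ L
      pair⊆L w∈ with x∈p∪q⁻ ⁅ u ⁆ ⁅ v ⁆ w∈
      ... | inj₁ w∈u = singleton⊆L u∈L w∈u
      ... | inj₂ w∈v = singleton⊆L v∈L w∈v

      N⊆ : neighbours Γ (⁅ u ⁆ ∪ ⁅ v ⁆) ⊆ ⁅ M v ⁆
      N⊆ z∈ with ∈-neighbours⁻ Γ (⁅ u ⁆ ∪ ⁅ v ⁆) z∈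
      ... | w , w∈ , z∈Γw with x∈p∪q⁻ ⁅ u ⁆ ⁅ v ⁆ w∈
      ... | inj₁ w∈u with refl ← x∈⁅y⁆⇒x≡y u w∈u =
        subst (Subset._∈ ⁅ M v ⁆) (trans (sym Mu≡Mv) (unique u (M∈ u u∈L) z∈Γw)) (x∈⁅x⁆ _)
      ... | inj₂ w∈v with refl ← x∈⁅y⁆⇒x≡y v w∈v =
        subst (Subset._∈ ⁅ M v ⁆) (unique v (M∈ v v∈L) z∈Γw) (x∈⁅x⁆ _)

  -- Among the subgraphs that satisfy Hall's condition, one with fewest edges has no left vertex of
  -- degree two on account of `deleteEdge-Hall`, which reduces the claim to `hall-single`.
  hall : ∀ Γ L → Fin m → HallCondition Γ L → ¬ ¬ ∃ (MatchesOn Γ L)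
  hall Γ L y₀ H = do
    (_ , (Γ′ , Γ′⊆Γ , H′ , refl) , least) ← ¬¬-least HallSubgraph
      (Γ , (λ v h → h) , H , refl)
    -- By minimality, deleting any edge of `Γ′` destroys Hall's condition.
    stays ← pure λ {x} {y} y∈ (H″ : HallCondition (deleteEdge Γ′ x y) L) →
      <⇒≱ (edgeCount-deleteEdge Γ′ y∈) (least _
        (deleteEdge Γ′ x y , (λ v → Γ′⊆Γ v ∘ deleteEdge-⊆ Γ′ x y v) , H″ , refl))
    let (M , M∈ , M-inj) = hall-single Γ′ L y₀ H′ λ v {y} {z} y∈ z∈ →
          decidable-stable (y Fin.≟ z) λ y≢z →
          deleteEdge-Hall Γ′ H′ y≢z (stays y∈) (stays z∈)
    pure (M , (λ v v∈L → Γ′⊆Γ v (M∈ v v∈L)) , M-inj)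
    where
    HallSubgraph : ℕ → Set
    HallSubgraph c = ∃ λ Γ′ → (∀ v → Γ′ v ⊆ Γ v) × HallCondition Γ′ L × edgeCount Γ′ ≡ c

-- The coordinates are minimised one after another: a coordinate in `S` is fixed at its least value
-- before the recursion on the tails, and a coordinate outside `S` is left free. The predicate on
-- tails asks for an extension that agrees pointwise, which avoids function extensionality.
lexLeast : ∀ {n m} (S : Fin n → Set) (P : (Fin n → Fin m) → Set) → ∃ P →
           ¬ ¬ (∃ λ M → P M × (∀ M′ → P M′ →
             (∀ v → S v → M v ≡ M′ v) ⊎
             (∃ λ v → S v × M v Fin.< M′ v × (∀ u → S u → u Fin.< v → M u ≡ M′ u))))
lexLeast {zero}  S P (M , PM) = pure (M , PM , λ _ _ → inj₁ λ ())
lexLeast {suc n} {m} S P (M , PM) = do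
  yes s₀ ← ¬¬-excluded-middle {A = S zero}
    where no ¬s₀ → do
            (_ , (M₁ , PM₁ , refl₁) , least) ← lexLeast (S ∘ suc)
              (λ N → ∃ λ M → P M × (∀ i → M (suc i) ≡ N i)) (M ∘ suc , M , PM , λ _ → refl)
            pure (M₁ , PM₁ , λ M′ PM′ → lift M₁ M′ (λ s₀ → contradiction s₀ ¬s₀) refl₁
              (least (M′ ∘ suc) (M′ , PM′ , λ _ → refl)))
  (c , (M₀ , PM₀ , M₀≡c) , least₀) ← ¬¬-least
    (λ c → ∃ λ M → P M × toℕ (M zero) ≡ c) (M , PM , refl)
  (_ , (M₁ , PM₁ , M₁≡c , M₁≗) , least) ← lexLeast (S ∘ suc)
    (λ N → ∃ λ M → P M × toℕ (M zero) ≡ c × (∀ i → M (suc i) ≡ N i))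
    (M₀ ∘ suc , M₀ , PM₀ , M₀≡c , λ _ → refl)
  pure (M₁ , PM₁ , λ M′ PM′ → case-head s₀ M₁ M′ M₁≡c M₁≗
    (least₀ _ (M′ , PM′ , refl)) λ c≡ → least (M′ ∘ suc) (M′ , PM′ , sym c≡ , λ _ → refl))
  where
  Le : ∀ {n} (S : Fin n → Set) (M M′ : Fin n → Fin m) → Set
  Le S M M′ = (∀ v → S v → M v ≡ M′ v) ⊎
    (∃ λ v → S v × M v Fin.< M′ v × (∀ u → S u → u Fin.< v → M u ≡ M′ u))

  lift : ∀ M M′ {N} → (S zero → M zero ≡ M′ zero) → (∀ i → M (suc i) ≡ N i) →
         Le (S ∘ suc) N (M′ ∘ suc) → Le S M M′
  lift M M′ head M≗N (inj₁ eq) = inj₁ λ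
    { zero → head ; (suc v) sv → trans (M≗N v) (eq v sv) }
  lift M M′ head M≗N (inj₂ (v , sv , lt , before)) = inj₂
    (suc v , sv , subst (Fin._< M′ (suc v)) (sym (M≗N v)) lt , λ
      { zero s₀ _ → head s₀
      ; (suc u) su (s≤s u<v) → trans (M≗N u) (before u su u<v) })

  case-head : ∀ {c N} → S zero → ∀ M M′ → toℕ (M zero) ≡ c → (∀ i → M (suc i) ≡ N i) →
              c ≤ toℕ (M′ zero) → (c ≡ toℕ (M′ zero) → Le (S ∘ suc) N (M′ ∘ suc)) →
              Le S M M′
  case-head s₀ M M′ refl M≗N c≤ rest with m≤n⇒m<n∨m≡n c≤
  ... | inj₁ c<   = inj₂ (zero , s₀ , c< , λ u _ ())
  ... | inj₂ c≡   = lift M M′ (λ _ → toℕ-injective c≡) M≗N (rest c≡)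

imageₜ : ∀ {n k} → Vector (Fin n) k → Subset n
imageₜ {k = zero}  L = Subset.⊥
imageₜ {k = suc k} L = ⁅ L zero ⁆ ∪ imageₜ (L ∘ suc)

∣imageₜ∣≤ : ∀ {n k} (L : Vector (Fin n) k) → ∣ imageₜ L ∣ ≤ k
∣imageₜ∣≤ {n} {zero} L = ≤-reflexive (∣⊥∣≡0 n)
∣imageₜ∣≤ {k = suc k} L = ≤-trans (∣p∪q∣≤∣p∣+∣q∣ ⁅ L zero ⁆ _)
  (+-mono-≤ (≤-reflexive (∣⁅x⁆∣≡1 (L zero))) (∣imageₜ∣≤ (L ∘ suc)))

∈-imageₜ : ∀ {n k v} (L : Vector (Fin n) k) → v ∈ₜ L → v Subset.∈ imageₜ L
∈-imageₜ L (zero  , refl) = x∈p∪q⁺ (inj₁ (x∈⁅x⁆ _))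
∈-imageₜ L (suc i , refl) = x∈p∪q⁺ {p = ⁅ L zero ⁆} (inj₂ (∈-imageₜ (L ∘ suc) (i , refl)))

module _ {n m k : ℕ} {Γ : BipartiteGraph n m} (1≤k : 1 ≤ k) (exp : IsExpander k 1 Γ) where

  expander⇒Hall : ∀ {L} → ∣ L ∣ ≤ k → HallCondition Γ L
  expander⇒Hall ∣L∣≤k A A⊆L = subst (_≤ ∣ neighbours Γ A ∣) (*-identityˡ _)
    (exp A (≤-trans (p⊆q⇒∣p∣≤∣q∣ A⊆L) ∣L∣≤k))

  -- Expansion of a singleton makes the right side inhabited. The vertex serves as a default value
  -- in Hall's theorem and in the simulation.
  rightVertex : Fin n → Fin m
  rightVertex x = proj₁ (0<∣p∣⇒Nonempty (neighbours Γ ⁅ x ⁆)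
    (subst (_≤ ∣ neighbours Γ ⁅ x ⁆ ∣) (∣⁅x⁆∣≡1 x)
      (expander⇒Hall (≤-trans (≤-reflexive (∣⁅x⁆∣≡1 x)) 1≤k) ⁅ x ⁆ λ h → h)))

  smallestMatching : Fin n → (L : Vector (Fin n) k) → ¬ ¬ ∃ (IsSmallestMatching Γ L)
  smallestMatching x L = do
    (M , M∈ , M-inj) ← hall Γ (imageₜ L) (rightVertex x) (expander⇒Hall (∣imageₜ∣≤ L))
    lexLeast (_∈ₜ L) (IsMatching Γ L)
      ( M , (λ v v∈L → M∈ v (∈-imageₜ L v∈L))
      , λ u v u∈L v∈L → M-inj u v (∈-imageₜ L u∈L) (∈-imageₜ L v∈L) )

-- Oblivious programs

-- Vertices of a layer are numbers, while states are structured. Computation paths of compiled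
-- programs visit only codes of states after the initial vertex, so one inverse law is enough.
record Encoding (A : Set) : Set where
  field
    size          : ℕ
    encode        : A → Fin size
    decode        : Fin size → A
    decode-encode : ∀ a → decode (encode a) ≡ a

open Encoding

×-encoding : ∀ a b → Encoding (Fin a × Fin b)
×-encoding a b = record
  { size          = a * b
  ; encode        = λ (i , j) → Fin.combine i j
  ; decode        = Fin.remQuot b
  ; decode-encode = λ (i , j) → remQuot-combine i j
  }

module _ {A : Set} (E : Encoding A) where

  encodeVec : ∀ {S} → Vec A S → Fin (size E ^ S)
  encodeVec []       = zero
  encodeVec (a ∷ as) = Fin.combine (encode E a) (encodeVec as)

  decodeVec : ∀ S → Fin (size E ^ S) → Vec A S
  decodeVec zero    i = []
  decodeVec (suc S) i = let (a , as) = Fin.remQuot (size E ^ S) i in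
    decode E a ∷ decodeVec S as

  decodeVec-encodeVec : ∀ {S} (as : Vec A S) → decodeVec S (encodeVec as) ≡ as
  decodeVec-encodeVec []       = refl
  decodeVec-encodeVec {suc S} (a ∷ as) = trans
    (cong (λ (i , is) → decode E i ∷ decodeVec S is)
      (remQuot-combine (encode E a) (encodeVec as)))
    (cong₂ _∷_ (decode-encode E a) (decodeVec-encodeVec as))

  Vec-encoding : ∀ S → Encoding (Vec A S)
  Vec-encoding S = record
    { size          = size E ^ S
    ; encode        = encodeVec
    ; decode        = decodeVec S
    ; decode-encode = decodeVec-encodeVec
    }

-- One level of an oblivious program on f : [n] → [n] whose vertices are the
-- elements of St: a query and the edges.
Instr : ℕ → Set → Set → Set
Instr n St O = Fin n × (St → Fin n → St × List O)

module _ {n : ℕ} {St O : Set} where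

  exec : List (Instr n St O) → (Fin n → Fin n) → St → St × List O
  exec []             f s = s , []
  exec ((q , δ) ∷ is) f s =
    let (s₁ , os) = δ s (f q)
        (s₂ , ps) = exec is f s₁
    in s₂ , os ++ ps

  exec-++ : ∀ is {js} f s →
    let (s₁ , os) = exec is f s
        (s₂ , ps) = exec js f s₁
    in exec (is ++ js) f s ≡ (s₂ , os ++ ps)
  exec-++ []             f s = refl
  exec-++ ((q , δ) ∷ is) {js} f s =
    let (s₁ , os) = δ s (f q) in
    trans (cong (λ (t , ps) → t , os ++ ps) (exec-++ is f s₁))
      (cong (proj₁ (exec js f (proj₁ (exec is f s₁))) ,_) (sym (++-assoc os _ _)))

  exec-silent : ∀ is {js} f s {t} → exec is f s ≡ (t , []) →
                proj₂ (exec (is ++ js) f s) ≡ proj₂ (exec js f t)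
  exec-silent is {js} f s eq = trans (cong proj₂ (exec-++ is f s))
    (cong (λ (t , os) → os ++ proj₂ (exec js f t)) eq)

  module _ {A : Set} {g : A → List (Instr n St O)}
           {f : Fin n → Fin n} {o : O} where

    -- Each segment is treated from an arbitrary starting state, so no invariant has to be carried
    -- from one segment to the next. In the application this is possible because each slot program
    -- starts with `reset`.
    exec-concatMap⁺ : ∀ {x xs} → x ∈ xs → (∀ s → o ∈ proj₂ (exec (g x) f s)) →
                      ∀ s → o ∈ proj₂ (exec (concatMap g xs) f s)
    exec-concatMap⁺ (here refl) o∈ s =
      subst (_ ∈_) (sym (cong proj₂ (exec-++ (g _) f s))) (∈-++⁺ˡ (o∈ s))
    exec-concatMap⁺ {xs = y ∷ _} (there x∈xs) o∈ s =
      subst (_ ∈_) (sym (cong proj₂ (exec-++ (g y) f s)))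
        (∈-++⁺ʳ (proj₂ (exec (g y) f s)) (exec-concatMap⁺ x∈xs o∈ _))

    exec-concatMap⁻ : ∀ {Q : Set} xs → (∀ x s → o ∈ proj₂ (exec (g x) f s) → Q) →
                      ∀ s → o ∈ proj₂ (exec (concatMap g xs) f s) → Q
    exec-concatMap⁻ (x ∷ xs) sound s o∈
      with ∈-++⁻ (proj₂ (exec (g x) f s)) (subst (_ ∈_) (cong proj₂ (exec-++ (g x) f s)) o∈)
    ... | inj₁ o∈x  = sound x s o∈x
    ... | inj₂ o∈xs = exec-concatMap⁻ xs sound _ o∈xs

  module _ (E : Encoding St) where

    private D = pointerChasingDomain n

    compileInstr : Instr n St O → Layer D (List O) (size E) (size E)
    compileInstr (q , δ) = record
      { query = λ _ → q
      ; edge  = λ u a → let (s , os) = δ (decode E u) a in encode E s , os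
      }

    compileLayers : (is : List (Instr n St O)) →
                    Layers D (List O) (length is) (size E) (size E)
    compileLayers []       = []
    compileLayers (i ∷ is) = compileInstr i ∷ compileLayers is

    compileLayers-oblivious : ∀ is → ObliviousLayers (compileLayers is)
    compileLayers-oblivious []       = tt
    compileLayers-oblivious (i ∷ is) = (λ _ _ → refl) , compileLayers-oblivious is

    compileLayers-widths : ∀ {P : ℕ → Set} is → P (size E) → All P (widths (compileLayers is))
    compileLayers-widths []       p = p ∷ []
    compileLayers-widths (i ∷ is) p = p ∷ compileLayers-widths is p

    compileLayers-outputs : ∀ is f s →
      concat (proj₂ (run (compileLayers is) f (encode E s))) ≡ proj₂ (exec is f s)
    compileLayers-outputs []             f s = refl
    compileLayers-outputs ((q , δ) ∷ is) f s rewrite decode-encode E s =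
      cong (proj₂ (δ s (f q)) ++_) (compileLayers-outputs is f _)

    -- The unused query q₀ widens the single initial vertex to all of St.
    compile : Fin n → St → List (Instr n St O) → MultiOutputProgram D O
    compile q₀ s₀ is = record
      { time   = suc (length is)
      ; layers = record { query = λ _ → q₀ ; edge = λ _ _ → encode E s₀ , [] }
                 ∷ compileLayers is
      ; label  = λ _ → tt
      }

    compile-oblivious : ∀ q₀ s₀ is → Oblivious (compile q₀ s₀ is)
    compile-oblivious q₀ s₀ is = (λ _ _ → refl) , compileLayers-oblivious is

    compile-space : ∀ q₀ s₀ is {t} → size E ≤ 2 ^ t → HasSpace (compile q₀ s₀ is) t
    compile-space q₀ s₀ is {t} size≤ = m^n>0 2 t ∷ compileLayers-widths is size≤

    compile-outputs : ∀ q₀ s₀ is f → outputs (compile q₀ s₀ is) f ≡ proj₂ (exec is f s₀)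
    compile-outputs q₀ s₀ is f = compileLayers-outputs is f s₀

-- Instructions for a slot that depend on a parameter y ∈ Y of the slot.
SlotInstr : ℕ → Set → Set → Set → Set
SlotInstr n Y St O = Fin n × (Y → St → Fin n → St × List O)

module _ {n : ℕ} {Y St O : Set} where

  at : Y → SlotInstr n Y St O → Instr n St O
  at y (q , δ) = q , δ y

  -- The query does not depend on the parameter, so one answer serves all slots: the number of
  -- levels stays that of a single slot, and only the state grows with `S`.
  parallel : ∀ {S} → Vec Y S → SlotInstr n Y St O → Instr n (Vec St S) O
  parallel ys (q , δ) = q , λ s a →
    Vec.tabulate (λ j → proj₁ (δ (lookup ys j) (lookup s j) a)) ,
    concat (tabulate (λ j → proj₂ (δ (lookup ys j) (lookup s j) a)))

  parallel-outputs⁺ : ∀ {S} (ys : Vec Y S) is f s {o} j →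
    o ∈ proj₂ (exec (map (at (lookup ys j)) is) f (lookup s j)) →
    o ∈ proj₂ (exec (map (parallel ys) is) f s)
  parallel-outputs⁺ ys ((q , δ) ∷ is) f s j o∈
    with ∈-++⁻ (proj₂ (δ (lookup ys j) (lookup s j) (f q))) o∈
  ... | inj₁ o∈os = ∈-++⁺ˡ (∈-concat⁺′ o∈os (∈-tabulate⁺ j))
  ... | inj₂ o∈ps = ∈-++⁺ʳ _ (parallel-outputs⁺ ys is f _ j
    (subst (λ t → _ ∈ proj₂ (exec (map (at (lookup ys j)) is) f t))
      (sym (lookup∘tabulate _ j)) o∈ps))

  parallel-outputs⁻ : ∀ {S} (ys : Vec Y S) is f s {o} →
    o ∈ proj₂ (exec (map (parallel ys) is) f s) →
    ∃ λ j → o ∈ proj₂ (exec (map (at (lookup ys j)) is) f (lookup s j))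
  parallel-outputs⁻ ys ((q , δ) ∷ is) f s o∈
    with ∈-++⁻ (proj₂ (proj₂ (parallel ys (q , δ)) s (f q))) o∈
  ... | inj₁ o∈os with ∈-concat⁻′ _ o∈os
  ...   | _ , o∈ , ∈tab with ∈-tabulate⁻ {f = λ j → proj₂ (δ (lookup ys j) (lookup s j) (f q))} ∈tab
  ...   | j , refl = j , ∈-++⁺ˡ o∈
  parallel-outputs⁻ ys ((q , δ) ∷ is) f s o∈ | inj₂ o∈ps
    with parallel-outputs⁻ ys is f _ o∈ps
  ... | j , o∈ = j , ∈-++⁺ʳ _
    (subst (λ t → _ ∈ proj₂ (exec (map (at (lookup ys j)) is) f t))
      (lookup∘tabulate _ j) o∈)

-- A group always has `S` slots, even where too few right vertices are left to fill it; the surplus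
-- slots neither change state nor emit anything.
whenUsed : ∀ {n Y St O} → SlotInstr n Y St O → SlotInstr n (Maybe Y) St O
whenUsed (q , δ) = q , λ { nothing s a → s , [] ; (just y) s a → δ y s a }

module _ {n : ℕ} {Y St O : Set} where

  exec-idle : ∀ (is : List (SlotInstr n Y St O)) f s →
              exec (map (at nothing) (map whenUsed is)) f s ≡ (s , [])
  exec-idle []       f s = refl
  exec-idle (i ∷ is) f s = exec-idle is f s

  exec-used : ∀ y (is : List (SlotInstr n Y St O)) f s →
              exec (map (at (just y)) (map whenUsed is)) f s ≡ exec (map (at y) is) f s
  exec-used y []             f s = refl
  exec-used y ((q , δ) ∷ is) f s =
    cong (λ (t , os) → t , proj₂ (δ y s (f q)) ++ os) (exec-used y is f _)

-- Division of a list into groups of fixed size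

module _ {A : Set} where

  fill : ∀ S → List A → Vec (Maybe A) S
  fill zero    xs       = []
  fill (suc S) []       = nothing ∷ fill S []
  fill (suc S) (x ∷ xs) = just x ∷ fill S xs

  -- The number of groups is prescribed, which makes the recursion structural and the length exact.
  -- Groups beyond the end of the list consist of `nothing`.
  chunks : ∀ S → ℕ → List A → List (Vec (Maybe A) S)
  chunks S zero    xs = []
  chunks S (suc c) xs = fill S xs ∷ chunks S c (drop S xs)

  length-chunks : ∀ S c xs → length (chunks S c xs) ≡ c
  length-chunks S zero    xs = refl
  length-chunks S (suc c) xs = cong suc (length-chunks S c (drop S xs))

  fill-covers : ∀ S {x xs} → x ∈ xs →
                (∃ λ j → lookup (fill S xs) j ≡ just x) ⊎ x ∈ drop S xs
  fill-covers zero    x∈xs        = inj₂ x∈xs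
  fill-covers (suc S) (here refl) = inj₁ (zero , refl)
  fill-covers (suc S) (there x∈xs) with fill-covers S x∈xs
  ... | inj₁ (j , eq) = inj₁ (suc j , eq)
  ... | inj₂ x∈       = inj₂ x∈

  chunks-cover : ∀ S c {x xs} → length xs ≤ c * S → x ∈ xs →
                 ∃ λ v → v ∈ chunks S c xs × (∃ λ j → lookup v j ≡ just x)
  chunks-cover S zero {xs = []} z≤n ()
  chunks-cover S (suc c) {xs = xs} len x∈xs with fill-covers S x∈xs
  ... | inj₁ found = _ , here refl , found
  ... | inj₂ x∈    =
    let (v , v∈ , found) = chunks-cover S c
          (subst (_≤ c * S) (sym (length-drop S xs)) (m≤n+o⇒m∸n≤o _ S len)) x∈
    in v , there v∈ , found

  length-concatMap : ∀ {B : Set} (g : A → List B) xs →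
                     length (concatMap g xs) ≡ sum (map (length ∘ g) xs)
  length-concatMap g []       = refl
  length-concatMap g (x ∷ xs) =
    trans (length-++ (g x)) (cong (length (g x) +_) (length-concatMap g xs))

module _ {A B : Set} (g : A → List B) where

  gather : ∀ {S} → Vec (Maybe A) S → List B
  gather []             = []
  gather (nothing ∷ xs) = gather xs
  gather (just x  ∷ xs) = g x ++ gather xs

  ∈-gather : ∀ {S x b} (xs : Vec (Maybe A) S) j → lookup xs j ≡ just x → b ∈ g x →
             b ∈ gather xs
  ∈-gather (just x  ∷ xs) zero    refl b∈ = ∈-++⁺ˡ b∈
  ∈-gather (nothing ∷ xs) (suc j) eq   b∈ = ∈-gather xs j eq b∈
  ∈-gather (just x  ∷ xs) (suc j) eq   b∈ = ∈-++⁺ʳ (g x) (∈-gather xs j eq b∈)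

  gather-fill-[] : ∀ S → gather (fill S []) ≡ []
  gather-fill-[] zero    = refl
  gather-fill-[] (suc S) = gather-fill-[] S

  length-gather-fill : ∀ S xs →
    length (gather (fill S xs)) + sum (map (length ∘ g) (drop S xs)) ≡ sum (map (length ∘ g) xs)
  length-gather-fill zero    xs       = refl
  length-gather-fill (suc S) []       rewrite gather-fill-[] S = refl
  length-gather-fill (suc S) (x ∷ xs) = begin
    length (g x ++ gather (fill S xs)) + rest         ≡⟨ cong (_+ rest) (length-++ (g x)) ⟩
    length (g x) + length (gather (fill S xs)) + rest ≡⟨ +-assoc (length (g x)) _ _ ⟩
    length (g x) + (length (gather (fill S xs)) + rest)
      ≡⟨ cong (length (g x) +_) (length-gather-fill S xs) ⟩
    length (g x) + sum (map (length ∘ g) xs)          ∎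
    where
    open ≡-Reasoning
    rest = sum (map (length ∘ g) (drop S xs))

  -- This is why the scans of all groups together cost only one pass over the edges. Elements that
  -- the `c` groups do not reach are dropped, hence an inequality.
  length-gather-chunks : ∀ S c xs →
    sum (map (length ∘ gather) (chunks S c xs)) ≤ sum (map (length ∘ g) xs)
  length-gather-chunks S zero    xs = z≤n
  length-gather-chunks S (suc c) xs = begin
    length (gather (fill S xs)) + sum (map (length ∘ gather) (chunks S c (drop S xs)))
      ≤⟨ +-monoʳ-≤ _ (length-gather-chunks S c (drop S xs)) ⟩
    length (gather (fill S xs)) + sum (map (length ∘ g) (drop S xs))
      ≡⟨ length-gather-fill S xs ⟩
    sum (map (length ∘ g) xs) ∎
    where open ≤-Reasoning

-- Simulation of ExpanderMatching

sum-map-≤-const : ∀ {A : Set} {g : A → ℕ} {c} xs → (∀ x → g x ≤ c) →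
                  sum (map g xs) ≤ length xs * c
sum-map-≤-const []       g≤c = z≤n
sum-map-≤-const (x ∷ xs) g≤c = +-mono-≤ (g≤c x) (sum-map-≤-const xs g≤c)

sum-map-const-+ : ∀ {A : Set} (g : A → ℕ) c xs →
                  sum (map (λ x → c + g x) xs) ≡ length xs * c + sum (map g xs)
sum-map-const-+ g c []       = refl
sum-map-const-+ g c (x ∷ xs) = begin
  c + g x + sum (map (λ x → c + g x) xs)     ≡⟨ cong (c + g x +_) (sum-map-const-+ g c xs) ⟩
  c + g x + (length xs * c + sum (map g xs)) ≡⟨ +-assoc c _ _ ⟩
  c + (g x + (length xs * c + sum (map g xs)))
    ≡⟨ cong (c +_) (trans (sym (+-assoc (g x) _ _)) (trans
         (cong (_+ sum (map g xs)) (+-comm (g x) _)) (+-assoc (length xs * c) _ _))) ⟩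
  c + (length xs * c + (g x + sum (map g xs))) ≡⟨ +-assoc c _ _ ⟨
  c + length xs * c + (g x + sum (map g xs)) ∎
  where open ≡-Reasoning

module _ {A B : Set} {R : A → B → Set} (R? : ∀ a b → Dec (R a b)) where

  sum-map-filter-∷ : ∀ a as bs →
    length (filter (R? a) bs) + sum (map (λ b → length (filter (λ a → R? a b) as)) bs) ≡
    sum (map (λ b → length (filter (λ a → R? a b) (a ∷ as))) bs)
  sum-map-filter-∷ a as []       = refl
  sum-map-filter-∷ a as (b ∷ bs) with does (R? a b) | rearranged
    where
    count = length (filter (λ a → R? a b) as)
    rearranged = trans
      (x∙yz≈y∙xz +-commutativeSemigroup (length (filter (R? a) bs)) count
        (sum (map (λ b → length (filter (λ a → R? a b) as)) bs)))
      (cong (count +_) (sum-map-filter-∷ a as bs))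
  ... | true  | eq = cong suc eq
  ... | false | eq = eq

  -- Double counting of the related pairs. For the edges of a graph it turns the degrees of the
  -- right vertices into those of the left ones.
  sum-map-filter-swap : ∀ as bs →
    sum (map (λ a → length (filter (R? a) bs)) as) ≡
    sum (map (λ b → length (filter (λ a → R? a b) as)) bs)
  sum-map-filter-swap []       bs = sym (sum-map-const-0 bs)
    where
    sum-map-const-0 : ∀ {C : Set} (cs : List C) → sum (map (λ _ → 0) cs) ≡ 0
    sum-map-const-0 []       = refl
    sum-map-const-0 (_ ∷ cs) = sum-map-const-0 cs
  sum-map-filter-swap (a ∷ as) bs = trans
    (cong (length (filter (R? a) bs) +_) (sum-map-filter-swap as bs)) (sum-map-filter-∷ a as bs)

length-filter-tabulate : ∀ {A : Set} {Q : A → Set} (Q? : Decidable Q) {m} (g : Fin m → A)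
  (p : Subset m) → (∀ i → Q (g i) → i Subset.∈ p) → length (filter Q? (tabulate g)) ≤ ∣ p ∣
length-filter-tabulate Q? g []      Q⇒∈ = z≤n
length-filter-tabulate Q? g (x ∷ p) Q⇒∈ with Q? (g zero)
... | no _   = ≤-trans (length-filter-tabulate Q? (g ∘ suc) p (λ i q → drop-there (Q⇒∈ (suc i) q)))
                 (∣p∣≤∣x∷p∣ x p)
... | yes q₀ with Q⇒∈ zero q₀
... | Vec.here = s≤s (length-filter-tabulate Q? (g ∘ suc) p (λ i q → drop-there (Q⇒∈ (suc i) q)))

leftNeighbours : ∀ {n m} → BipartiteGraph n m → Fin m → List (Fin n)
leftNeighbours {n} Γ y = filter (λ v → y ∈? Γ v) (allFin n)

sum-leftNeighbours : ∀ {n m} (Γ : BipartiteGraph n m) →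
                     sum (map (length ∘ leftNeighbours Γ) (allFin m)) ≤ edgeCount Γ
sum-leftNeighbours {n} {m} Γ = begin
  sum (map (length ∘ leftNeighbours Γ) (allFin m))
    ≡⟨ sum-map-filter-swap (λ y v → y ∈? Γ v) (allFin m) (allFin n) ⟩
  sum (map (λ v → length (filter (_∈? Γ v) (allFin m))) (allFin n))
    ≤⟨ sum-map-mono-≤ (allFin n) (λ v →
         length-filter-tabulate (_∈? Γ v) (λ i → i) (Γ v) λ _ h → h) ⟩
  edgeCount Γ ∎
  where open ≤-Reasoning

-- The value with which a simulated program with first variable y continues
-- when the query to f returns a.
value : ∀ {n m k} → Fin m → Fin n → Input (expanderMatchingDomain n m k)
value y a zero    = y
value y a (suc i) = a

matchingInput : ∀ {n m k} → Fin m → Vector (Fin n) k → Input (expanderMatchingDomain n m k)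
matchingInput y L zero    = y
matchingInput y L (suc i) = L i

-- All layers of the simulated program are embedded into one common vertex set. This is the way
-- back, with the default `r` for numbers that are no vertex of the layer.
narrow : ∀ {w W} → Fin w → Fin W → Fin w
narrow {w} r i with toℕ i <? w
... | yes i<w = fromℕ< i<w
... | no  _   = r

narrow-inject≤ : ∀ {w W} (r u : Fin w) (w≤W : w ≤ W) → narrow r (inject≤ u w≤W) ≡ u
narrow-inject≤ {w} r u w≤W with toℕ (inject≤ u w≤W) <? w
... | yes h = trans (fromℕ<-cong _ _ (toℕ-inject≤ u w≤W) h (toℕ<n u)) (fromℕ<-toℕ u (toℕ<n u))
... | no ¬h = contradiction (subst (_< w) (sym (toℕ-inject≤ u w≤W)) (toℕ<n u)) ¬h

module _ {N} {D : Fin N → ℕ} {E : Set} {P : ℕ → Set} where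

  All-widths-source : ∀ {T w w′} (ls : Layers D E T w w′) → All P (widths ls) → P w
  All-widths-source []       (p ∷ _) = p
  All-widths-source (l ∷ ls) (p ∷ _) = p

  All-widths-target : ∀ {T w w′} (ls : Layers D E T w w′) → All P (widths ls) → P w′
  All-widths-target []       (p ∷ _)  = p
  All-widths-target (l ∷ ls) (_ ∷ ps) = All-widths-target ls ps

module Simulation {n m k W : ℕ} (x₀ : Fin n) (y₀ : Fin m) (b : Vector (Fin n) k) where

  private D = expanderMatchingDomain n m k

  -- A vertex of the simulated program, and a value of f found later.
  Slot : Set
  Slot = Fin W × Fin n

  Instruction : Set
  Instruction = SlotInstr n (Fin m) Slot (Fin n × Fin n)

  -- The slot knows `y`, so a level that reads variable 0 needs no information about `f`; it queries
  -- `x₀` and ignores the answer.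
  fQuery : Fin (suc k) → Fin n
  fQuery zero    = x₀
  fQuery (suc i) = b i

  value-fQuery : ∀ (y : Fin m) (f : Fin n → Fin n) i →
                 value y (f (fQuery i)) i ≡ matchingInput y (f ∘ b) i
  value-fQuery y f zero    = refl
  value-fQuery y f (suc i) = refl

  module _ {w w′} (l : Layer D ⊤ w w′) (w′≤W : w′ ≤ W) (r : Fin w) where

    simulateEdge : Fin m → Slot → Fin n → Slot × List (Fin n × Fin n)
    simulateEdge y (u , z) a =
      let v = narrow r u in
      (inject≤ (proj₁ (Layer.edge l v (value y a (Layer.query l v)))) w′≤W , z) , []

    simulateEdge-correct : ∀ w≤W y f u z → Layer.query l u ≡ Layer.query l r →
      simulateEdge y (inject≤ u w≤W , z) (f (fQuery (Layer.query l r))) ≡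
      ((inject≤ (proj₁ (Layer.edge l u (matchingInput y (f ∘ b) (Layer.query l u)))) w′≤W , z) , [])
    simulateEdge-correct w≤W y f u z same
      rewrite narrow-inject≤ r u w≤W | sym same =
      cong (λ a → (inject≤ (proj₁ (Layer.edge l u a)) w′≤W , z) , [])
        (value-fQuery y f (Layer.query l u))

  -- In an oblivious program the queries can be read off the computation path
  -- from any reference vertex r.
  simulate : ∀ {T w w′} (ls : Layers D ⊤ T w w′) → All (_≤ W) (widths ls) → Fin w →
             List Instruction
  simulate []       _             r = []
  simulate (l ∷ ls) (_ ∷ widths≤) r =
    (fQuery (Layer.query l r) , simulateEdge l (All-widths-source ls widths≤) r) ∷
    simulate ls widths≤ (proj₁ (Layer.edge l r (value y₀ x₀ (Layer.query l r))))

  length-simulate : ∀ {T w w′} (ls : Layers D ⊤ T w w′) widths≤ r →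
                    length (simulate ls widths≤ r) ≡ T
  length-simulate []       _             r = refl
  length-simulate (l ∷ ls) (_ ∷ widths≤) r = cong suc (length-simulate ls widths≤ _)

  exec-simulate : ∀ {T w w′} (ls : Layers D ⊤ T w w′) (widths≤ : All (_≤ W) (widths ls)) r →
    ObliviousLayers ls → ∀ (w≤W : w ≤ W) (w′≤W : w′ ≤ W) y f u z →
    exec (map (at y) (simulate ls widths≤ r)) f (inject≤ u w≤W , z) ≡
    ((inject≤ (proj₁ (run ls (matchingInput y (f ∘ b)) u)) w′≤W , z) , [])
  exec-simulate [] _ r _ w≤W w′≤W y f u z =
    cong (λ le → (inject≤ u le , z) , []) (≤-irrelevant w≤W w′≤W)
  exec-simulate (l ∷ ls) (_ ∷ widths≤) r (same , obl) w≤W w′≤W y f u z = trans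
    (cong (λ (σ , os) →
        let (τ , ps) = exec (map (at y) (simulate ls widths≤ r′)) f σ in τ , os ++ ps)
      (simulateEdge-correct l (All-widths-source ls widths≤) r w≤W y f u z (same u r)))
    (exec-simulate ls widths≤ r′ obl (All-widths-source ls widths≤) w′≤W y f _ z)
    where r′ = proj₁ (Layer.edge l r (value y₀ x₀ (Layer.query l r)))

-- The program of one slot

module SlotProgram
  {n m k : ℕ} (x₀ : Fin n) (y₀ : Fin m)
  (P : SingleOutputProgram (expanderMatchingDomain n m k) (Maybe (Fin n)))
  (oblivious : Oblivious P) {s : ℕ} (space : HasSpace P s) (b : Vector (Fin n) k)
  where

  open Simulation {W = 2 ^ s} x₀ y₀ b
  open Program P

  private
    1≤W : 1 ≤ 2 ^ s
    1≤W = All-widths-source layers space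

    last≤W : last ≤ 2 ^ s
    last≤W = All-widths-target layers space

    -- The default for `narrow` in the last layer; a run on an arbitrary input provides such a
    -- vertex.
    reference : Fin last
    reference = proj₁ (run layers (matchingInput y₀ (λ _ → x₀)) zero)

  matched : Fin (2 ^ s) → Maybe (Fin n)
  matched u = label (narrow reference u)

  matched? : ∀ u v → Dec (matched u ≡ just v)
  matched? u v = Maybe.≡-dec Fin._≟_ (matched u) (just v)

  reset : Instruction
  reset = x₀ , λ y (u , z) a → (inject≤ zero 1≤W , z) , []

  store : Fin n → Instruction
  store v = v , λ y (u , z) a → (u , (if does (matched? u v) then a else z)) , []

  -- The values of `f` on the block are not stored. They are queried again and compared with the
  -- matched vertex, whose own value under `f` is by then in `z`.
  emit : Fin k → Instruction
  emit i = b i , λ y (u , z) a → (u , z) , (if does (matched? u a) then (b i , z) ∷ [] else [])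

  slotProgram : List (Fin n) → List Instruction
  slotProgram qs = reset ∷ simulate layers space zero ++ map store qs ++ map emit (allFin k)

  length-slotProgram : ∀ qs → length (slotProgram qs) ≡ suc (time + (length qs + k))
  length-slotProgram qs = cong suc (begin
    length (simulate layers space zero ++ map store qs ++ map emit (allFin k))
      ≡⟨ length-++ (simulate layers space zero) ⟩
    length (simulate layers space zero) + length (map store qs ++ map emit (allFin k))
      ≡⟨ cong₂ _+_ (length-simulate layers space zero) (length-++ (map store qs)) ⟩
    time + (length (map store qs) + length (map emit (allFin k)))
      ≡⟨ cong (time +_) (cong₂ _+_ (length-map store qs)
           (trans (length-map emit (allFin k)) (length-tabulate {n = k} (λ i → i)))) ⟩
    time + (length qs + k) ∎)
    where open ≡-Reasoning

  module _ (y : Fin m) (f : Fin n → Fin n) where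

    matchedTo : Maybe (Fin n)
    matchedTo = finalLabel P (matchingInput y (f ∘ b))

    -- A correct `z` stays correct: it is overwritten only when the matched vertex is scanned again,
    -- and then by the same value.
    exec-store-stored : ∀ {v} qs u z → matched u ≡ just v → z ≡ f v →
      exec (map (at y) (map store qs)) f (u , z) ≡ ((u , f v) , [])
    exec-store-stored []       u z eq refl = refl
    exec-store-stored {v} (q ∷ qs) u z eq z≡ with matched? u q
    ... | yes eq′ = exec-store-stored qs u (f q) eq (cong f (just-injective (trans (sym eq′) eq)))
    ... | no  _   = exec-store-stored qs u z eq z≡

    exec-store-∈ : ∀ {v} qs u z → matched u ≡ just v → v ∈ qs →
      exec (map (at y) (map store qs)) f (u , z) ≡ ((u , f v) , [])
    exec-store-∈ {v} (q ∷ qs) u z eq v∈ with matched? u q | v∈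
    ... | yes eq′ | _         =
      exec-store-stored qs u (f q) eq (cong f (just-injective (trans (sym eq′) eq)))
    ... | no  ¬eq | here refl = contradiction eq ¬eq
    ... | no  ¬eq | there v∈′ = exec-store-∈ qs u z eq v∈′

    exec-store : ∀ qs u z → ∃ λ z′ →
      exec (map (at y) (map store qs)) f (u , z) ≡ ((u , z′) , []) ×
      (∀ {v} → matched u ≡ just v → v ∈ qs → z′ ≡ f v)
    exec-store []       u z = z , refl , λ _ ()
    exec-store (q ∷ qs) u z =
      let (z′ , eq , _) = exec-store qs u (if does (matched? u q) then f q else z)
      in z′ , eq , λ u≡v v∈ → cong (proj₂ ∘ proj₁)
          (trans (sym eq) (exec-store-∈ (q ∷ qs) u z u≡v v∈))

    emit-outputs⁺ : ∀ is u z {i} → i ∈ is → matched u ≡ just (f (b i)) →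
      (b i , z) ∈ proj₂ (exec (map (at y) (map emit is)) f (u , z))
    emit-outputs⁺ (i ∷ is) u z (here refl) eq with matched? u (f (b i))
    ... | yes _  = here refl
    ... | no ¬eq = contradiction eq ¬eq
    emit-outputs⁺ (i ∷ is) u z (there i∈) eq = ∈-++⁺ʳ
      (if does (matched? u (f (b i))) then (b i , z) ∷ [] else []) (emit-outputs⁺ is u z i∈ eq)

    emit-outputs⁻ : ∀ is u z {o} → o ∈ proj₂ (exec (map (at y) (map emit is)) f (u , z)) →
      ∃ λ i → o ≡ (b i , z) × matched u ≡ just (f (b i))
    emit-outputs⁻ (i ∷ is) u z o∈ with matched? u (f (b i)) | o∈
    ... | yes eq | here refl  = i , refl , eq
    ... | yes eq | there o∈is = emit-outputs⁻ is u z o∈is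
    ... | no _   | o∈is       = emit-outputs⁻ is u z o∈is

    -- The state `σ` may be left over from an earlier part: `reset` restores the initial vertex, and
    -- an old `z₀` has been replaced whenever there is a matched vertex in `qs`.
    slotProgram-outputs : ∀ qs σ → ∃₂ λ u z →
      matched u ≡ matchedTo × (∀ {v} → matchedTo ≡ just v → v ∈ qs → z ≡ f v) ×
      proj₂ (exec (map (at y) (slotProgram qs)) f σ) ≡
      proj₂ (exec (map (at y) (map emit (allFin k))) f (u , z))
    slotProgram-outputs qs (u₀ , z₀) =
      u , z , matched-u , (λ eq → stored (trans matched-u eq)) , (begin
      proj₂ (exec (map (at y) (sim ++ sto ++ emi)) f σ₁)
        ≡⟨ cong (λ is → proj₂ (exec is f σ₁)) (trans (map-++ (at y) sim _)
             (cong (map (at y) sim ++_) (map-++ (at y) sto emi))) ⟩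
      proj₂ (exec (map (at y) sim ++ map (at y) sto ++ map (at y) emi) f σ₁)
        ≡⟨ exec-silent (map (at y) sim) f σ₁
             (exec-simulate layers space zero oblivious 1≤W last≤W y f zero z₀) ⟩
      proj₂ (exec (map (at y) sto ++ map (at y) emi) f (u , z₀))
        ≡⟨ exec-silent (map (at y) sto) f _ sto≡ ⟩
      proj₂ (exec (map (at y) emi) f (u , z)) ∎)
      where
      open ≡-Reasoning
      sim = simulate layers space zero
      sto = map store qs
      emi = map emit (allFin k)
      σ₁  = inject≤ {1} zero 1≤W , z₀
      v   = proj₁ (run layers (matchingInput y (f ∘ b)) zero)
      u   = inject≤ v last≤W
      z   = proj₁ (exec-store qs u z₀)
      sto≡   = proj₁ (proj₂ (exec-store qs u z₀))
      stored = proj₂ (proj₂ (exec-store qs u z₀))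
      matched-u : matched u ≡ matchedTo
      matched-u = cong label (narrow-inject≤ reference v last≤W)

    slotProgram-outputs⁺ : ∀ qs σ {i} → matchedTo ≡ just (f (b i)) → f (b i) ∈ qs →
      (b i , f (f (b i))) ∈ proj₂ (exec (map (at y) (slotProgram qs)) f σ)
    slotProgram-outputs⁺ qs σ eq ∈qs with slotProgram-outputs qs σ
    ... | u , z , u≡ , stored , out≡ rewrite out≡ | sym (stored eq ∈qs) =
      emit-outputs⁺ (allFin k) u z (∈-allFin _) (trans u≡ eq)

    -- A pair is emitted only when the matched vertex is `f (b i)`. As `complete` puts that vertex
    -- among those scanned, the emitted `z` is its value and not a leftover.
    slotProgram-outputs⁻ : ∀ qs σ {x z} → (∀ {v} → matchedTo ≡ just v → v ∈ qs) →
      (x , z) ∈ proj₂ (exec (map (at y) (slotProgram qs)) f σ) → z ≡ f (f x)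
    slotProgram-outputs⁻ qs σ complete o∈ with slotProgram-outputs qs σ
    ... | u , z , u≡ , stored , out≡
      with emit-outputs⁻ (allFin k) u z (subst (_ ∈_) out≡ o∈)
    ... | i , refl , eq = let to≡ = trans (sym u≡) eq in stored to≡ (complete to≡)

-- Pointer chasing

module PointerChasing
  {n m k s : ℕ} (S B C : ℕ) (x₀ : Fin n) {Γ : BipartiteGraph n m}
  (1≤k : 1 ≤ k) (exp : IsExpander k 1 Γ)
  (P : SingleOutputProgram (expanderMatchingDomain n m k) (Maybe (Fin n)))
  (oblivious : Oblivious P) (space : HasSpace P s) (solves : SolvesExpanderMatching Γ P)
  where

  private
    y₀ : Fin m
    y₀ = rightVertex 1≤k exp x₀

    Slot : Set
    Slot = Fin (2 ^ s) × Fin n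

  -- Padding an incomplete block with `x₀` is harmless, as it can only add correct pairs for `x₀`.
  entry : Vec (Maybe (Fin n)) k → Vector (Fin n) k
  entry v i = fromMaybe x₀ (lookup v i)

  module _ (v : Vec (Maybe (Fin n)) k) where
    open SlotProgram x₀ y₀ P oblivious {s} space (entry v) public

  candidates : Vec (Maybe (Fin m)) S → List (Fin n)
  candidates = gather (leftNeighbours Γ)

  part : Vec (Maybe (Fin n)) k → Vec (Maybe (Fin m)) S → List (Instr n (Vec Slot S) (Fin n × Fin n))
  part v ys = map (parallel ys) (map whenUsed (slotProgram v (candidates ys)))

  blocks : List (Vec (Maybe (Fin n)) k)
  blocks = chunks k B (allFin n)

  slots : List (Vec (Maybe (Fin m)) S)
  slots = chunks S C (allFin m)

  instrs : List (Instr n (Vec Slot S) (Fin n × Fin n))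
  instrs = concatMap (λ v → concatMap (part v) slots) blocks

  encoding : Encoding (Vec Slot S)
  encoding = Vec-encoding (×-encoding (2 ^ s) n) S

  initial : Vec Slot S
  initial = replicate S (fromℕ< (m^n>0 2 s) , x₀)

  chase : MultiOutputProgram (pointerChasingDomain n) (Fin n × Fin n)
  chase = compile encoding x₀ initial instrs

  length-part : ∀ v ys → length (part v ys) ≡ suc (Program.time P + k) + length (candidates ys)
  length-part v ys = begin
    length (part v ys)                     ≡⟨ length-map (parallel ys) (map whenUsed is) ⟩
    length (map whenUsed is)               ≡⟨ length-map whenUsed is ⟩
    length is                              ≡⟨ length-slotProgram v (candidates ys) ⟩
    suc (T + (length (candidates ys) + k)) ≡⟨ cong (λ c → suc (T + c)) (+-comm _ k) ⟩
    suc (T + (k + length (candidates ys))) ≡⟨ cong suc (+-assoc T k _) ⟨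
    suc (T + k) + length (candidates ys)   ∎
    where
    open ≡-Reasoning
    T  = Program.time P
    is = slotProgram v (candidates ys)

  chase-time : Program.time chase ≤ suc (B * (C * suc (Program.time P + k) + edgeCount Γ))
  chase-time = s≤s (begin
    length instrs ≡⟨ length-concatMap (λ v → concatMap (part v) slots) blocks ⟩
    sum (map (λ v → length (concatMap (part v) slots)) blocks)
      ≤⟨ sum-map-≤-const blocks per-block ⟩
    length blocks * X ≡⟨ cong (_* X) (length-chunks k B (allFin n)) ⟩
    B * X ∎)
    where
    open ≤-Reasoning
    c = suc (Program.time P + k)
    X = C * c + edgeCount Γ
    per-block : ∀ v → length (concatMap (part v) slots) ≤ X
    per-block v = begin
      length (concatMap (part v) slots)       ≡⟨ length-concatMap (part v) slots ⟩
      sum (map (length ∘ part v) slots)       ≡⟨ cong sum (map-cong (length-part v) slots) ⟩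
      sum (map (λ ys → c + length (candidates ys)) slots)
        ≡⟨ sum-map-const-+ (length ∘ candidates) c slots ⟩
      length slots * c + sum (map (length ∘ candidates) slots)
        ≤⟨ +-mono-≤ (≤-reflexive (cong (_* c) (length-chunks S C (allFin m))))
             (≤-trans (length-gather-chunks (leftNeighbours Γ) S C (allFin m))
               (sum-leftNeighbours Γ)) ⟩
      X ∎

  chase-space : ∀ {t} → 2 ^ s * n ≤ 2 ^ t → HasSpace chase (t * S)
  chase-space {t} le = compile-space encoding x₀ initial instrs {t * S} (begin
    (2 ^ s * n) ^ S ≤⟨ ^-monoˡ-≤ S le ⟩
    (2 ^ t) ^ S     ≡⟨ ^-*-assoc 2 t S ⟩
    2 ^ (t * S)     ∎)
    where open ≤-Reasoning

  module _ (f : Fin n → Fin n) where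

    module _ (v : Vec (Maybe (Fin n)) k) {M} (least : IsSmallestMatching Γ (f ∘ entry v) M) where

      -- The output for `y` is matched to `y` by `M`, hence adjacent to `y` in `Γ`. Scanning the
      -- neighbours of the right vertices in the group therefore finds it.
      matchedTo⇒candidate : ∀ {y u} ys j → lookup ys j ≡ just y →
                            matchedTo v y f ≡ just u → u ∈ candidates ys
      matchedTo⇒candidate {y} {u} ys j eq to≡
        with solves (matchingInput y (f ∘ entry v)) M least
      ... | preimage rewrite to≡ = let (u∈L , Mu≡y) = preimage in
        ∈-gather (leftNeighbours Γ) ys j eq
          (∈-filter⁺ (λ v → y ∈? Γ v) (∈-allFin u)
            (subst (Subset._∈ Γ u) Mu≡y (proj₁ (proj₁ least) u u∈L)))

      -- Injectivity of `M` leaves no other preimage, and ⊥ is excluded because a preimage exists.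
      matchedTo-M : ∀ i → matchedTo v (M (f (entry v i))) f ≡ just (f (entry v i))
      matchedTo-M i with matchedTo v (M (f (entry v i))) f
                       | solves (matchingInput (M (f (entry v i))) (f ∘ entry v)) M least
      ... | just u  | (u∈L , Mu≡) = cong just (proj₂ (proj₁ least) u _ u∈L (i , refl) Mu≡)
      ... | nothing | unmatched   = contradiction refl (unmatched _ (i , refl))

    part-sound : ∀ v ys σ {x z} → (x , z) ∈ proj₂ (exec (part v ys) f σ) → z ≡ f (f x)
    part-sound v ys σ {x} {z} o∈ = decidable-stable (z Fin.≟ f (f x)) λ z≢ →
      smallestMatching 1≤k exp x₀ (f ∘ entry v) λ (M , least) →
      z≢ (sound least)
      where
      is = slotProgram v (candidates ys)
      sound : ∀ {M} → IsSmallestMatching Γ (f ∘ entry v) M → z ≡ f (f x)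
      sound least with parallel-outputs⁻ ys (map whenUsed is) f σ o∈
      ... | j , o∈j with lookup ys j in eq
      ...   | nothing = contradiction
                (subst (_ ∈_) (cong proj₂ (exec-idle is f (lookup σ j))) o∈j) λ ()
      ...   | just y  = slotProgram-outputs⁻ v y f (candidates ys) (lookup σ j)
                (matchedTo⇒candidate v least ys j eq)
                (subst (_ ∈_) (cong proj₂ (exec-used y is f (lookup σ j))) o∈j)

    chase-sound : ∀ {x z} → (x , z) ∈ outputs chase f → z ≡ f (f x)
    chase-sound o∈ = exec-concatMap⁻ blocks
      (λ v → exec-concatMap⁻ slots (λ ys σ → part-sound v ys σ)) initial
      (subst (_ ∈_) (compile-outputs encoding x₀ initial instrs f) o∈)

    part-complete : ∀ v {M} → IsSmallestMatching Γ (f ∘ entry v) M → ∀ i ys j →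
      lookup ys j ≡ just (M (f (entry v i))) → ∀ σ →
      (entry v i , f (f (entry v i))) ∈ proj₂ (exec (part v ys) f σ)
    part-complete v {M} least i ys j eq σ = parallel-outputs⁺ ys (map whenUsed is) f σ j
      (subst (λ y → _ ∈ proj₂ (exec (map (at y) (map whenUsed is)) f (lookup σ j))) (sym eq)
        (subst (_ ∈_) (sym (cong proj₂ (exec-used (M (f (entry v i))) is f (lookup σ j))))
          (slotProgram-outputs⁺ v (M (f (entry v i))) f (candidates ys) (lookup σ j)
            (matchedTo-M v least i)
            (matchedTo⇒candidate v least ys j eq (matchedTo-M v least i)))))
      where is = slotProgram v (candidates ys)

    -- The pair is emitted by the group that contains the partner of `f (entry v i)`. Which group
    -- this is depends on `M`, available only under double negation, but membership in the list of
    -- outputs is decidable.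
    block-complete : m ≤ C * S → ∀ {v} → v ∈ blocks → ∀ i →
                     (entry v i , f (f (entry v i))) ∈ outputs chase f
    block-complete m≤ {v} v∈ i = decidable-stable (_ ∈ₗ? outputs chase f) λ ∉ →
      smallestMatching 1≤k exp x₀ (f ∘ entry v) λ (M , least) →
      let (ys , ys∈ , j , eq) = chunks-cover S C
            (≤-trans (≤-reflexive (length-tabulate {n = m} λ i → i)) m≤)
            (∈-allFin (M (f (entry v i)))) in
      ∉ (subst ((entry v i , f (f (entry v i))) ∈_)
          (sym (compile-outputs encoding x₀ initial instrs f))
          (exec-concatMap⁺ v∈ (exec-concatMap⁺ ys∈ (part-complete v least i ys j eq)) initial))
      where
      open import Data.List.Membership.DecPropositional (≡-dec Fin._≟_ Fin._≟_)
        using () renaming (_∈?_ to _∈ₗ?_)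

    chase-complete : n ≤ B * k → m ≤ C * S → ∀ x → (x , f (f x)) ∈ outputs chase f
    chase-complete n≤ m≤ x =
      let (v , v∈ , i , eq) = chunks-cover k B
            (≤-trans (≤-reflexive (length-tabulate {n = n} λ i → i)) n≤) (∈-allFin x)
      in subst (λ x → (x , f (f x)) ∈ outputs chase f) (cong (fromMaybe x₀) eq)
           (block-complete m≤ v∈ i)

    chase-correct : n ≤ B * k → m ≤ C * S → ∀ x z → (x , z) ∈ outputs chase f ⇔ z ≡ f (f x)
    chase-correct n≤ m≤ x z = mk⇔ chase-sound λ { refl → chase-complete n≤ m≤ x }

-- Time and space bounds

open ≤-Reasoning

argmin : ∀ (U : ℕ → ℕ) n → ∃ λ i → i < suc n × (∀ j → j < suc n → U i ≤ U j)
argmin U zero    = 0 , s≤s z≤n , λ { zero _ → ≤-refl ; (suc j) (s≤s ()) }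
argmin U (suc n) with argmin U n
... | i , i< , min with U i ≤? U (suc n)
...   | yes le = i , m≤n⇒m≤1+n i< , λ j j< → case j (m<1+n⇒m<n∨m≡n j<) le
  where
  case : ∀ j → j < suc n ⊎ j ≡ suc n → U i ≤ U (suc n) → U i ≤ U j
  case j (inj₁ j<)   le = min j j<
  case j (inj₂ refl) le = le
...   | no gt = suc n , ≤-refl , λ j j< → case j (m<1+n⇒m<n∨m≡n j<)
  where
  case : ∀ j → j < suc n ⊎ j ≡ suc n → U (suc n) ≤ U j
  case j (inj₁ j<)   = ≤-trans (≰⇒≥ gt) (min j j<)
  case j (inj₂ refl) = ≤-refl

-- The search runs downwards from the top. Failure at the successor later yields the lower bound on
-- the balanced block size; the top of the range is the exceptional case.
largest : ∀ {Q : ℕ → Set} → Decidable Q → Q 1 → ∀ n →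
          ∃ λ j → j < suc n × Q (suc j) × (suc j ≡ suc n ⊎ ¬ Q (suc (suc j)))
largest Q? q₁ zero = 0 , s≤s z≤n , q₁ , inj₁ refl
largest Q? q₁ (suc n) with Q? (suc (suc n))
... | yes q = suc n , ≤-refl , q , inj₁ refl
... | no ¬q with largest Q? q₁ n
...   | j , j< , q , inj₁ refl = j , m≤n⇒m≤1+n j< , q , inj₂ ¬q
...   | j , j< , q , inj₂ ¬q′  = j , m≤n⇒m≤1+n j< , q , inj₂ ¬q′

^-distribʳ-* : ∀ q a b → (a * b) ^ q ≡ a ^ q * b ^ q
^-distribʳ-* zero    a b = refl
^-distribʳ-* (suc q) a b = trans (cong (a * b *_) (^-distribʳ-* q a b))
  ([m*n]*[o*p]≡[m*o]*[n*p] a b (a ^ q) (b ^ q))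

^-swap : ∀ a x y → (a ^ x) ^ y ≡ (a ^ y) ^ x
^-swap a x y = begin-equality
  (a ^ x) ^ y ≡⟨ ^-*-assoc a x y ⟩
  a ^ (x * y) ≡⟨ cong (a ^_) (*-comm x y) ⟩
  a ^ (y * x) ≡⟨ ^-*-assoc a y x ⟨
  (a ^ y) ^ x ∎

^-cancelˡ-≤ : ∀ {a b} r .{{_ : NonZero r}} → a ^ r ≤ b ^ r → a ≤ b
^-cancelˡ-≤ r le = ≮⇒≥ λ b<a → <⇒≱ (^-monoˡ-< r b<a) le

-- Both sides of the conclusion are compared after raising them to the power
-- q + p.
root-bound : ∀ {n S Z} q p .{{_ : NonZero q}} → 1 ≤ n → S ≤ n →
             n ^ (q + p) * S ^ q ≤ Z ^ (q + p) → n ^ q * S ^ q ≤ Z ^ q * n ^ p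
root-bound {n} {S} {Z} q p 1≤n S≤n hyp =
  ^-cancelˡ-≤ r {{>-nonZero (≤-trans (>-nonZero⁻¹ q) (m≤m+n q p))}} (begin
  (n ^ q * S ^ q) ^ r                 ≡⟨ ^-distribʳ-* r (n ^ q) (S ^ q) ⟩
  (n ^ q) ^ r * (S ^ q) ^ r           ≡⟨ cong₂ _*_ (^-swap n q r) (^-distribˡ-+-* (S ^ q) q p) ⟩
  (n ^ r) ^ q * ((S ^ q) ^ q * (S ^ q) ^ p) ≡⟨ *-assoc ((n ^ r) ^ q) _ _ ⟨
  (n ^ r) ^ q * (S ^ q) ^ q * (S ^ q) ^ p
    ≡⟨ cong (_* (S ^ q) ^ p) (^-distribʳ-* q (n ^ r) (S ^ q)) ⟨
  (n ^ r * S ^ q) ^ q * (S ^ q) ^ p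
    -- The hypothesis is used to the power `q`; the remaining power of `S` is bounded by `S ≤ n`.
    ≤⟨ *-mono-≤ (^-monoˡ-≤ q hyp) (^-monoˡ-≤ p (^-monoˡ-≤ q S≤n)) ⟩
  (Z ^ r) ^ q * (n ^ q) ^ p           ≡⟨ cong₂ _*_ (^-swap Z r q) (^-swap n q p) ⟩
  (Z ^ q) ^ r * (n ^ p) ^ q
    ≤⟨ *-monoʳ-≤ ((Z ^ q) ^ r) (^-monoʳ-≤ (n ^ p) {{>-nonZero 1≤n^p}} (m≤m+n q p)) ⟩
  (Z ^ q) ^ r * (n ^ p) ^ r           ≡⟨ ^-distribʳ-* r (Z ^ q) (n ^ p) ⟨
  (Z ^ q * n ^ p) ^ r                 ∎)
  where
  r = q + p
  1≤n^p : 1 ≤ n ^ p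
  1≤n^p = m^n>0 n {{>-nonZero 1≤n}} p

-- The balanced block size with p/q in place of α: up to rounding,
-- k^(2+2p/q) = n^(1+p/q) S.
blockSize : ∀ n S q p .{{_ : NonZero q}} → 1 ≤ S → S ≤ suc n →
  let r = q + p ; N = suc n in
  ∃ λ j → let k = suc j in j < N ×
    k ^ r * k ^ r ≤ N ^ r * S ^ q ×
    N ^ q * S ^ q ≤ (2 ^ q * k ^ q) * (2 ^ q * k ^ q) * N ^ p
blockSize n S q p 1≤S S≤N = bounds (largest
  (λ k → k ^ r * k ^ r ≤? N ^ r * S ^ q)
  (≤-trans (≤-reflexive (cong₂ _*_ (^-zeroˡ r) (^-zeroˡ r)))
    (*-mono-≤ (m^n>0 N r) (m^n>0 S {{>-nonZero 1≤S}} q))) n)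
  where
  r = q + p
  N = suc n

  twice : ∀ k → (2 ^ q * k ^ q) * (2 ^ q * k ^ q) ≡ ((2 * k) * (2 * k)) ^ q
  twice k = begin-equality
    (2 ^ q * k ^ q) * (2 ^ q * k ^ q) ≡⟨ cong₂ _*_ (^-distribʳ-* q 2 k) (^-distribʳ-* q 2 k) ⟨
    (2 * k) ^ q * (2 * k) ^ q         ≡⟨ ^-distribʳ-* q (2 * k) (2 * k) ⟨
    ((2 * k) * (2 * k)) ^ q           ∎

  bounds : (∃ λ j → j < N × suc j ^ r * suc j ^ r ≤ N ^ r * S ^ q ×
             (suc j ≡ N ⊎ ¬ (suc (suc j) ^ r * suc (suc j) ^ r ≤ N ^ r * S ^ q))) → _
  -- At the top of the range, `k = N`, the lower bound follows from `S ≤ N` alone.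
  bounds (j , j< , A , inj₁ refl) = j , j< , A , (begin
    N ^ q * S ^ q ≤⟨ *-monoʳ-≤ (N ^ q) (^-monoˡ-≤ q S≤N) ⟩
    N ^ q * N ^ q ≤⟨ *-mono-≤ (m≤n*m _ (2 ^ q) {{m^n≢0 2 q}}) (m≤n*m _ (2 ^ q) {{m^n≢0 2 q}}) ⟩
    (2 ^ q * N ^ q) * (2 ^ q * N ^ q) ≤⟨ m≤m*n _ (N ^ p) {{m^n≢0 N p}} ⟩
    (2 ^ q * N ^ q) * (2 ^ q * N ^ q) * N ^ p ∎)
  -- Here `k + 1` is already too large, and `k + 1 ≤ 2k` accounts for the factors `2 ^ q`.
  bounds (j , j< , A , inj₂ ¬A) = j , j< , A , (begin
    N ^ q * S ^ q ≤⟨ root-bound q p (s≤s z≤n) S≤N (begin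
      N ^ r * S ^ q           ≤⟨ <⇒≤ (≰⇒> ¬A) ⟩
      suc k ^ r * suc k ^ r   ≡⟨ ^-distribʳ-* r (suc k) (suc k) ⟨
      (suc k * suc k) ^ r     ≤⟨ ^-monoˡ-≤ r (*-mono-≤ suc-k≤ suc-k≤) ⟩
      ((2 * k) * (2 * k)) ^ r ∎) ⟩
    ((2 * k) * (2 * k)) ^ q * N ^ p ≡⟨ cong (_* N ^ p) (twice k) ⟨
    (2 ^ q * k ^ q) * (2 ^ q * k ^ q) * N ^ p ∎)
    where
    k = suc j
    suc-k≤ : suc k ≤ 2 * k
    suc-k≤ = s≤s (≤-trans (≤-reflexive (+-comm 1 j)) (+-monoʳ-≤ j (s≤s z≤n)))

-- The time of the program with n/k + 1 blocks and m/S + 1 groups of slots.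
timeBound : (n m k S t e : ℕ) .{{_ : NonZero k}} .{{_ : NonZero S}} → ℕ
timeBound n m k S t e = suc (suc (n / k) * (suc (m / S) * suc (t * k + k) + e * n))

[1+m/n]*n≤m+n : ∀ m n .{{_ : NonZero n}} → suc (m / n) * n ≤ m + n
[1+m/n]*n≤m+n m n = ≤-trans (+-monoʳ-≤ n (m/n*n≤m m n)) (≤-reflexive (+-comm n m))

m≤[1+m/n]*n : ∀ m n .{{_ : NonZero n}} → m ≤ suc (m / n) * n
m≤[1+m/n]*n m n = begin
  m                   ≡⟨ m≡m%n+[m/n]*n m n ⟩
  m % n + m / n * n   ≤⟨ +-monoˡ-≤ (m / n * n) (<⇒≤ (m%n<n m n)) ⟩
  n + m / n * n       ∎

factor : ℕ → ℕ → ℕ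
factor t e = 5 + 2 * t + 2 * e

-- Multiplication by `k * S` clears both rounded quotients, as `B * k ≤ 2 * n` and `C * S ≤ m + S`.
-- The lower-order terms `k * S` and `n * S * k` are absorbed by `n * n * S`.
timeBound-≤ : ∀ n m k S t e .{{_ : NonZero k}} .{{_ : NonZero S}} → k ≤ n →
  timeBound n m k S t e * (k * S) ≤ factor t e * (n * m * k + n * n * S)
timeBound-≤ n m k S t e k≤n = begin
  suc (B * (C * suc (t * k + k) + e * n)) * (k * S)
    ≡⟨ expand B C (suc (t * k + k)) (e * n) k S ⟩
  k * S + (B * k) * (C * S * suc (t * k + k) + e * n * S)
    ≤⟨ +-mono-≤ (*-monoˡ-≤ S k≤nn) (*-mono-≤
         (≤-trans ([1+m/n]*n≤m+n n k) (+-monoʳ-≤ n k≤n))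
         (+-monoˡ-≤ (e * n * S) (*-mono-≤ ([1+m/n]*n≤m+n m S) (+-monoˡ-≤ (t * k + k) 1≤k)))) ⟩
  n * n * S + (n + n) * ((m + S) * (k + (t * k + k)) + e * n * S)
    ≡⟨ collect n m k S t e ⟩
  (4 + 2 * t) * (n * m * k) + (4 + 2 * t) * (n * S * k) + (1 + 2 * e) * (n * n * S)
    ≤⟨ +-monoˡ-≤ ((1 + 2 * e) * (n * n * S))
         (+-monoʳ-≤ ((4 + 2 * t) * (n * m * k)) (*-monoʳ-≤ (4 + 2 * t) nSk≤)) ⟩
  (4 + 2 * t) * (n * m * k) + (4 + 2 * t) * (n * n * S) + (1 + 2 * e) * (n * n * S)
    -- The added term makes both coefficients equal to `(4 + 2 * t) + (1 + 2 * e)`, which is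
    -- `factor t e`.
    ≤⟨ m≤m+n _ _ ⟩
  (4 + 2 * t) * (n * m * k) + (4 + 2 * t) * (n * n * S) + (1 + 2 * e) * (n * n * S) +
  (1 + 2 * e) * (n * m * k)
    ≡⟨ assemble t e (n * m * k) (n * n * S) ⟩
  factor t e * (n * m * k + n * n * S) ∎
  where
  B = suc (n / k)
  C = suc (m / S)
  1≤k : 1 ≤ k
  1≤k = >-nonZero⁻¹ k
  k≤nn : k ≤ n * n
  k≤nn = ≤-trans k≤n (m≤m*n n n {{>-nonZero (≤-trans 1≤k k≤n)}})
  nSk≤ : n * S * k ≤ n * n * S
  nSk≤ = ≤-trans (*-monoʳ-≤ (n * S) k≤n) (≤-reflexive (swap n S))
    where
    swap : ∀ n S → n * S * n ≡ n * n * S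
    swap = solve-∀
  expand : ∀ B C c d k S → suc (B * (C * c + d)) * (k * S) ≡ k * S + (B * k) * (C * S * c + d * S)
  expand = solve-∀
  collect : ∀ n m k S t e → n * n * S + (n + n) * ((m + S) * (k + (t * k + k)) + e * n * S) ≡
    (4 + 2 * t) * (n * m * k) + (4 + 2 * t) * (n * S * k) + (1 + 2 * e) * (n * n * S)
  collect = solve-∀
  assemble : ∀ t e x y → (4 + 2 * t) * x + (4 + 2 * t) * y + (1 + 2 * e) * y + (1 + 2 * e) * x ≡
    (5 + 2 * t + 2 * e) * (x + y)
  assemble = solve-∀

-- The two summands of the time bound, one for the simulations and one for the
-- scans of f.
timeBound-cases : ∀ n m k S t e .{{_ : NonZero k}} .{{_ : NonZero S}} → k ≤ n →
  let U = timeBound n m k S t e ; c = 2 * factor t e in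
  U * S ≤ c * (n * m) ⊎ U * k ≤ c * (n * n)
timeBound-cases n m k S t e k≤n with ≤-total (n * n * S) (n * m * k)
... | inj₁ le = inj₁ (*-cancelʳ-≤ _ _ k (begin
  U * S * k                             ≡⟨ trans (*-assoc U S k) (cong (U *_) (*-comm S k)) ⟩
  U * (k * S)                           ≤⟨ timeBound-≤ n m k S t e k≤n ⟩
  c * (n * m * k + n * n * S)           ≤⟨ *-monoʳ-≤ c (+-monoʳ-≤ (n * m * k) le) ⟩
  c * (n * m * k + n * m * k)           ≡⟨ double c (n * m) k ⟩
  2 * c * (n * m) * k                   ∎))
  where
  U = timeBound n m k S t e
  c = factor t e
  double : ∀ c x y → c * (x * y + x * y) ≡ 2 * c * x * y
  double = solve-∀
... | inj₂ le = inj₂ (*-cancelʳ-≤ _ _ S (begin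
  U * k * S                             ≡⟨ *-assoc U k S ⟩
  U * (k * S)                           ≤⟨ timeBound-≤ n m k S t e k≤n ⟩
  c * (n * m * k + n * n * S)           ≤⟨ *-monoʳ-≤ c (+-monoˡ-≤ (n * n * S) le) ⟩
  c * (n * n * S + n * n * S)           ≡⟨ double c (n * n) S ⟩
  2 * c * (n * n) * S                   ∎))
  where
  U = timeBound n m k S t e
  c = factor t e
  double : ∀ c x y → c * (x * y + x * y) ≡ 2 * c * x * y
  double = solve-∀

-- In the next two lemmas the letters stand for powers with exponent q, except
-- that ρ = k^(q+p), ω = n^(q+p) and π = n^p.
simulations-dominate : ∀ u σ c ν μ γ ρ ω .{{_ : NonZero σ}} →
  u * σ ≤ c * (ν * μ) → μ ≤ γ * ρ → ρ * ρ ≤ ω * σ →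
  u * u * σ ≤ (c * γ) * (c * γ) * (ν * ν * ω)
simulations-dominate u σ c ν μ γ ρ ω uσ≤ μ≤ ρρ≤ = *-cancelʳ-≤ _ _ σ (begin
  u * u * σ * σ                               ≡⟨ square u σ ⟩
  (u * σ) * (u * σ)                           ≤⟨ *-mono-≤ uσ≤′ uσ≤′ ⟩
  (c * (ν * (γ * ρ))) * (c * (ν * (γ * ρ)))   ≡⟨ regroup c ν γ ρ ⟩
  (c * γ) * (c * γ) * (ν * ν) * (ρ * ρ)       ≤⟨ *-monoʳ-≤ ((c * γ) * (c * γ) * (ν * ν)) ρρ≤ ⟩
  (c * γ) * (c * γ) * (ν * ν) * (ω * σ)       ≡⟨ reassoc ((c * γ) * (c * γ)) (ν * ν) ω σ ⟩
  (c * γ) * (c * γ) * (ν * ν * ω) * σ         ∎)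
  where
  uσ≤′ : u * σ ≤ c * (ν * (γ * ρ))
  uσ≤′ = ≤-trans uσ≤ (*-monoʳ-≤ c (*-monoʳ-≤ ν μ≤))
  square : ∀ u σ → u * u * σ * σ ≡ (u * σ) * (u * σ)
  square = solve-∀
  regroup : ∀ c ν γ ρ → (c * (ν * (γ * ρ))) * (c * (ν * (γ * ρ))) ≡
    (c * γ) * (c * γ) * (ν * ν) * (ρ * ρ)
  regroup = solve-∀
  reassoc : ∀ x y ω σ → x * y * (ω * σ) ≡ x * (y * ω) * σ
  reassoc = solve-∀

scans-dominate : ∀ u σ c ν κ d π .{{_ : NonZero ν}} .{{_ : NonZero κ}} →
  u * κ ≤ c * (ν * ν) → ν * σ ≤ (d * κ) * (d * κ) * π →
  u * u * σ ≤ (c * d) * (c * d) * (ν * ν * (ν * π))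
scans-dominate u σ c ν κ d π uκ≤ νσ≤ = *-cancelʳ-≤ _ _ (ν * (κ * κ))
  {{m*n≢0 ν (κ * κ) {{it}} {{m*n≢0 κ κ}}}} (begin
  u * u * σ * (ν * (κ * κ))                         ≡⟨ square u σ ν κ ⟩
  (u * κ) * (u * κ) * (ν * σ)                       ≤⟨ *-mono-≤ (*-mono-≤ uκ≤ uκ≤) νσ≤ ⟩
  (c * (ν * ν)) * (c * (ν * ν)) * ((d * κ) * (d * κ) * π) ≡⟨ regroup c ν κ d π ⟩
  (c * d) * (c * d) * (ν * ν * (ν * π)) * (ν * (κ * κ)) ∎)
  where
  square : ∀ u σ ν κ → u * u * σ * (ν * (κ * κ)) ≡ (u * κ) * (u * κ) * (ν * σ)
  square = solve-∀
  regroup : ∀ c ν κ d π → (c * (ν * ν)) * (c * (ν * ν)) * ((d * κ) * (d * κ) * π) ≡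
    (c * d) * (c * d) * (ν * ν * (ν * π)) * (ν * (κ * κ))
  regroup = solve-∀

-- Polylogarithmic functions

Polylog-const : ∀ c → Polylog (λ _ → c)
Polylog-const c = c , 0 , λ n → ≤-reflexive (sym (*-identityʳ c))

Polylog-log : Polylog (λ n → 1 + ⌊log₂ n ⌋)
Polylog-log = 1 , 1 , λ n → ≤-reflexive (sym (trans (*-identityˡ _) (*-identityʳ _)))

Polylog-+ : ∀ {g h} → Polylog g → Polylog h → Polylog (λ n → g n + h n)
Polylog-+ {g} {h} (C , c , g≤) (D , d , h≤) = C + D , c + d , λ n →
  let l = suc ⌊log₂ n ⌋ in begin
  g n + h n                             ≤⟨ +-mono-≤ (g≤ n) (h≤ n) ⟩
  C * l ^ c + D * l ^ d                 ≤⟨ +-mono-≤ (*-monoʳ-≤ C (^-monoʳ-≤ l (m≤m+n c d)))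
                                             (*-monoʳ-≤ D (^-monoʳ-≤ l (m≤n+m d c))) ⟩
  C * l ^ (c + d) + D * l ^ (c + d)     ≡⟨ *-distribʳ-+ (l ^ (c + d)) C D ⟨
  (C + D) * l ^ (c + d)                 ∎

Polylog-* : ∀ {g h} → Polylog g → Polylog h → Polylog (λ n → g n * h n)
Polylog-* {g} {h} (C , c , g≤) (D , d , h≤) = C * D , c + d , λ n →
  let l = suc ⌊log₂ n ⌋ in begin
  g n * h n                   ≤⟨ *-mono-≤ (g≤ n) (h≤ n) ⟩
  C * l ^ c * (D * l ^ d)     ≡⟨ [m*n]*[o*p]≡[m*o]*[n*p] C (l ^ c) D (l ^ d) ⟩
  C * D * (l ^ c * l ^ d)     ≡⟨ cong (C * D *_) (^-distribˡ-+-* l c d) ⟨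
  C * D * l ^ (c + d)         ∎

n≤2^[1+⌊log₂n⌋] : ∀ n → n ≤ 2 ^ (1 + ⌊log₂ n ⌋)
n≤2^[1+⌊log₂n⌋] n = ≮⇒≥ λ lt → 1+n≰n (begin
  1 + ⌊log₂ n ⌋               ≡⟨ ⌊log₂[2^n]⌋≡n (1 + ⌊log₂ n ⌋) ⟨
  ⌊log₂ 2 ^ (1 + ⌊log₂ n ⌋) ⌋ ≤⟨ ⌊log₂⌋-mono-≤ (<⇒≤ lt) ⟩
  ⌊log₂ n ⌋                   ∎)

-- Each half of the balance serves one case: the upper bound on `k` where the simulations dominate,
-- the lower bound where the scans dominate.
timeBound-power : ∀ N m j S t e g q p .{{_ : NonZero q}} .{{_ : NonZero S}} →
  let k = suc j ; n = suc N ; U = timeBound n m k S t e ; c = 4 * factor t e * suc g in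
  k ≤ n → m ^ q ≤ g ^ q * k ^ (q + p) →
  k ^ (q + p) * k ^ (q + p) ≤ n ^ (q + p) * S ^ q →
  n ^ q * S ^ q ≤ (2 ^ q * k ^ q) * (2 ^ q * k ^ q) * n ^ p →
  (U ^ 2 * S) ^ q ≤ (c ^ 2) ^ q * n ^ (3 * q + p)
timeBound-power N m j S t e g q p k≤n m≤ A B = begin
  (U ^ 2 * S) ^ q                            ≡⟨ powers U S ⟩
  U ^ q * U ^ q * S ^ q                      ≤⟨ main (timeBound-cases n m k S t e k≤n) ⟩
  c ^ q * c ^ q * (n ^ q * n ^ q * (n ^ q * n ^ p)) ≡⟨ cong₂ _*_ (squares c) cube ⟨
  (c ^ 2) ^ q * n ^ (3 * q + p)              ∎
  where
  k = suc j
  n = suc N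
  U = timeBound n m k S t e
  c₀ = 2 * factor t e
  c = 4 * factor t e * suc g
  instance
    _ = m^n≢0 S q
    _ = m^n≢0 n q
    _ = m^n≢0 k q

  squares : ∀ a → (a ^ 2) ^ q ≡ a ^ q * a ^ q
  squares a = trans (cong (λ b → (a * b) ^ q) (*-identityʳ a)) (^-distribʳ-* q a a)

  powers : ∀ a b → (a ^ 2 * b) ^ q ≡ a ^ q * a ^ q * b ^ q
  powers a b = trans (^-distribʳ-* q (a ^ 2) b) (cong (_* b ^ q) (squares a))

  cube : n ^ (3 * q + p) ≡ n ^ q * n ^ q * (n ^ q * n ^ p)
  cube = trans (cong (n ^_) (exponent q p)) (trans (^-distribˡ-+-* n (q + q) (q + p))
    (cong₂ _*_ (^-distribˡ-+-* n q q) (^-distribˡ-+-* n q p)))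
    where
    exponent : ∀ q p → 3 * q + p ≡ (q + q) + (q + p)
    exponent = solve-∀

  raise : ∀ a b d x y → a * b ≤ d * (x * y) → a ^ q * b ^ q ≤ d ^ q * (x ^ q * y ^ q)
  raise a b d x y le = subst₂ _≤_ (^-distribʳ-* q a b)
    (trans (^-distribʳ-* q d (x * y)) (cong (d ^ q *_) (^-distribʳ-* q x y)))
    (^-monoˡ-≤ q le)

  absorb : ∀ a → c₀ * a ≤ c → c₀ ^ q * a ^ q ≤ c ^ q
  absorb a le = subst (_≤ c ^ q) (^-distribʳ-* q c₀ a) (^-monoˡ-≤ q le)

  -- One constant covers both cases: `c₀ * g` for the simulations, and `c₀ * 2` for the scans, with
  -- the 2 from rounding `k`. The successor of `g` keeps it large enough for the latter when `g` is
  -- 0.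
  c₀g≤c : c₀ * g ≤ c
  c₀g≤c = *-mono-≤ (*-monoˡ-≤ (factor t e) {2} {4} (s≤s (s≤s z≤n))) (n≤1+n g)

  c₀2≤c : c₀ * 2 ≤ c
  c₀2≤c = ≤-trans (≤-reflexive (double (factor t e))) (m≤m*n (4 * factor t e) (suc g))
    where
    double : ∀ x → 2 * x * 2 ≡ 4 * x
    double = solve-∀

  main : U * S ≤ c₀ * (n * m) ⊎ U * k ≤ c₀ * (n * n) →
         U ^ q * U ^ q * S ^ q ≤ c ^ q * c ^ q * (n ^ q * n ^ q * (n ^ q * n ^ p))
  main (inj₁ US≤) = begin
    U ^ q * U ^ q * S ^ q
      ≤⟨ simulations-dominate (U ^ q) (S ^ q) (c₀ ^ q) (n ^ q) (m ^ q) (g ^ q) _ (n ^ (q + p))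
           (raise U S c₀ n m US≤) m≤ A ⟩
    (c₀ ^ q * g ^ q) * (c₀ ^ q * g ^ q) * (n ^ q * n ^ q * n ^ (q + p))
      ≤⟨ *-mono-≤ (*-mono-≤ (absorb g c₀g≤c) (absorb g c₀g≤c))
           (≤-reflexive (cong (n ^ q * n ^ q *_) (^-distribˡ-+-* n q p))) ⟩
    c ^ q * c ^ q * (n ^ q * n ^ q * (n ^ q * n ^ p)) ∎
  main (inj₂ Uk≤) = begin
    U ^ q * U ^ q * S ^ q
      ≤⟨ scans-dominate (U ^ q) (S ^ q) (c₀ ^ q) (n ^ q) (k ^ q) (2 ^ q) (n ^ p)
           (raise U k c₀ n n Uk≤) B ⟩
    (c₀ ^ q * 2 ^ q) * (c₀ ^ q * 2 ^ q) * (n ^ q * n ^ q * (n ^ q * n ^ p))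
      ≤⟨ *-monoˡ-≤ _ (*-mono-≤ (absorb 2 c₀2≤c) (absorb 2 c₀2≤c)) ⟩
    c ^ q * c ^ q * (n ^ q * n ^ q * (n ^ q * n ^ p)) ∎

theorem4p3 : (α : ℝ) → Positive α → (F : ExpanderFamily α) → ExpanderMatchingEasy F → PointerChasingEasy α
theorem4p3 α _ F (s , t , s-polylog , t-polylog , easy) =
  -- A slot holds a simulated vertex, of `s n` bits, and one element of `[n]`.
  (λ n → s n + (1 + ⌊log₂ n ⌋)) ,
  (λ n → 4 * factor (t n) (e n) * suc (g n)) ,
  Polylog-+ s-polylog Polylog-log ,
  Polylog-* (Polylog-* (Polylog-const 4)
    (Polylog-+ (Polylog-+ (Polylog-const 5) (Polylog-* (Polylog-const 2) t-polylog))
      (Polylog-* (Polylog-const 2) e-polylog)))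
    (Polylog-+ (Polylog-const 1) g-polylog) ,
  construct
  where
  open ExpanderFamily F
  e = proj₁ edges-bound
  g = proj₁ right-bound
  e-polylog = proj₁ (proj₂ edges-bound)
  g-polylog = proj₁ (proj₂ right-bound)

  construct : ∀ n S → 1 ≤ S → S ≤ n →
    Σ (MultiOutputProgram (pointerChasingDomain n) (Fin n × Fin n))
    λ P → Oblivious P × HasSpace P ((s n + (1 + ⌊log₂ n ⌋)) * S) ×
          PowerBound α (Program.time P ^ 2 * S) ((4 * factor (t n) (e n) * suc (g n)) ^ 2) n 3 ×
          SolvesPointerChasing P
  construct zero S 1≤S S≤0 with () ← ≤-trans 1≤S S≤0
  construct n@(suc N) S@(suc _) 1≤S S≤n =
    chase , compile-oblivious encoding zero initial instrs ,
    chase-space {t = s n + (1 + ⌊log₂ n ⌋)} space≤ ,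
    power ,
    λ f → chase-correct f (m≤[1+m/n]*n n k) (m≤[1+m/n]*n (m n k) S)
    where
    U : ℕ → ℕ
    U j = timeBound n (m n (suc j)) (suc j) S (t n) (e n)

    optimal = argmin U N
    j = proj₁ optimal
    k = suc j
    k≤n : k ≤ n
    k≤n = proj₁ (proj₂ optimal)

    matcher = easy n k (s≤s z≤n) k≤n
    P = proj₁ matcher
    open PointerChasing {s = s n} S (suc (n / k)) (suc (m n k / S)) zero (s≤s z≤n)
      (isExpander n k (s≤s z≤n) k≤n) P (proj₁ (proj₂ matcher)) (proj₁ (proj₂ (proj₂ matcher)))
      (proj₂ (proj₂ (proj₂ (proj₂ matcher))))

    space≤ : 2 ^ s n * n ≤ 2 ^ (s n + (1 + ⌊log₂ n ⌋))
    space≤ = begin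
      2 ^ s n * n                     ≤⟨ *-monoʳ-≤ (2 ^ s n) (n≤2^[1+⌊log₂n⌋] n) ⟩
      2 ^ s n * 2 ^ (1 + ⌊log₂ n ⌋)   ≡⟨ ^-distribˡ-+-* 2 (s n) (1 + ⌊log₂ n ⌋) ⟨
      2 ^ (s n + (1 + ⌊log₂ n ⌋))     ∎

    time≤ : Program.time chase ≤ U j
    time≤ = ≤-trans chase-time (s≤s (*-monoʳ-≤ (suc (n / k)) (+-mono-≤
      (*-monoʳ-≤ (suc (m n k / S)) (s≤s (+-monoˡ-≤ k (proj₁ (proj₂ (proj₂ (proj₂ matcher)))))))
      (proj₂ (proj₂ edges-bound) n k (s≤s z≤n) k≤n))))

    power : PowerBound α (Program.time chase ^ 2 * S) ((4 * factor (t n) (e n) * suc (g n)) ^ 2) n 3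
    power p q above with blockSize N S q p 1≤S S≤n
    ... | i , i< , A , B = ≤-trans
      -- The block size of the program is fixed before `p` and `q` are given. Its time bound is
      -- minimal, hence at most that of the size balanced for this `p/q`.
      (^-monoˡ-≤ q (*-monoˡ-≤ S (^-monoˡ-≤ 2 (≤-trans time≤ (proj₂ (proj₂ optimal) i i<)))))
      (timeBound-power N (m n (suc i)) i S (t n) (e n) (g n) q p i<
        (subst (λ x → m n (suc i) ^ q ≤ g n ^ q * suc i ^ (x + p)) (*-identityˡ q)
          (proj₂ (proj₂ right-bound) n (suc i) (s≤s z≤n) i< p q above)) A B)
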